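{- Let $p$ be a prime, and let $d$ and $t$ be positive integers. Assume that $x_1^{k_1}x_2^{k_2}\cdots x_{p^t}^{k_{p^t}}$ is the cycle type of a complete mapping of the additive group $\mathbb{F}_p^t$. For $\ell=1,2,\ldots,p^t$ and $i=1,2,\ldots,k_{\ell}$, let $\gamma_{\ell,i}\in\Gamma(d,p,\ell)$. Then for every $d$-dimensional $\mathbb{F}_p$-subspace $W$ of $\mathbb{F}_p^{d+t}$, the $\mathbb{F}_p$-vector space $\mathbb{F}_p^{d+t}$ admits a $W$-coset-wise $\mathbb{F}_p$-affine complete mapping whose cycle type is \[ \prod_{\ell=1}^{p^t}\prod_{i=1}^{k_{\ell}}\operatorname{BU}_{\ell}(\gamma_{\ell,i}). \]
   Context: A complete mapping of an additive group $G$ is a permutation $f$ of $G$ such that $x\mapsto f(x)+x$ is also a permutation of $G$. The cycle type $\operatorname{CT}(\sigma)$ of a permutation $\sigma$ of a finite set $\Omega$ is the monomial $x_1^{k_1}x_2^{k_2}\cdots x_{|\Omega|}^{k_{|\Omega|}}\in\mathbb{Q}[x_n:n\geq1]$, where $k_\ell$ is the number of cycles of length $\ell$ of $\sigma$; for a set $X$ of permutations, $\operatorname{CT}(X)=\{\operatorname{CT}(\sigma):\sigma\in X\}$. For a positive integer $\ell$, $\operatorname{BU}_\ell$ is the unique $\mathbb{Q}$-algebra endomorphism of $\mathbb{Q}[x_n:n\geq1]$ with $\operatorname{BU}_\ell(x_n)=x_{\ell n}$ for all $n\geq1$. Vectors in $\mathbb{F}_p^d$ are row vectors. For a $(d\times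 d)$-matrix $M$ over $\mathbb{F}_p$ and $v\in\mathbb{F}_p^d$, $\lambda(M,v)$ denotes the map $\mathbb{F}_p^d\to\mathbb{F}_p^d$, $x\mapsto xM+v$. $\operatorname{AGL}_d(p)=\{\lambda(M,v): M\in\operatorname{GL}_d(p), v\in\mathbb{F}_p^d\}$. $\operatorname{CGL}_d(p)$ is the set of matrices $A\in\operatorname{GL}_d(p)$ that do not have $-1$ as an eigenvalue, and $\operatorname{ACGL}_d(p)=\{\lambda(A,v):A\in\operatorname{CGL}_d(p),v\in\mathbb{F}_p^d\}$. Define \[ \Gamma(d,p,\ell)=\begin{cases}\operatorname{CT}(\operatorname{ACGL}_d(p)), & \ell=1,\\ \operatorname{CT}(\operatorname{AGL}_d(p)), & \ell\geq2,\ (d,p)\notin\{(1,2),(1,3),(2,2)\},\\ \emptyset, & \ell\geq2,\ (d,p)=(1,2),\\ \{x_1^3,x_3\}, & \ell\ge2,\ (d,p)=(1,3),\\ \{x_1^4,x_2^2,x_1x_3\}, & \ell\geq 2,\ (d,p)=(2,2).\end{cases} \] For a field $K$, a $K$-vector space $V$ and a subspace $W$, a function $f:V\to V$ is $W$-coset-wise $K$-affine if for each coset $C$ of $W$ in $V$ there are $v_C\in V$ and a $K$-linear endomorphism $\varphi_C$ of $V$ with $\varphi_C(W)\subseteq W$ such that $f(x)=\varphi_C(x)+v_C$ for all $x\in C$. -}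

module Defs where

open import Algebra.Bundles using (RawMonoid; CommutativeSemiring)
open import Algebra.Core using (Op₂)
import Algebra.Definitions.RawMonoid as RawMonoidOps
import Algebra.Definitions.RawSemiring as RawSemiringOps
open import Algebra.Structures.Biased using (isCommutativeSemiringˡ)
open import Data.Fin.Base using (Fin; toℕ; finToFun)
import Data.Fin.Properties as Fin
open import Data.List.Base using (List; length; map; filter; deduplicate; iterate; allFin)
import Data.List.Membership.DecPropositional as DecMembership
open import Data.Nat.Base as ℕ using (ℕ; suc; NonZero; _∸_; _≥_)
open import Data.Nat.DivMod using (_mod_)
import Data.Nat.Properties as ℕ
open import Data.Product.Base using (Σ-syntax; ∃-syntax; _×_; _,_)
open import Data.Rational.Base as ℚ using (ℚ; 0ℚ; 1ℚ)
open import Data.Sum.Base using (_⊎_)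
open import Data.Vec.Base as Vec using (Vec; zipWith; replicate; tabulate; lookup)
import Data.Vec.Properties as Vec
open import Function.Definitions using (Bijective)
open import Level using (0ℓ)
open import Relation.Binary.Definitions using (DecidableEquality)
open import Relation.Binary.PropositionalEquality.Core using (_≡_; _≢_)
open import Relation.Binary.Structures using (IsEquivalence)
open import Relation.Nullary.Decidable using (yes; no)
open import Relation.Nullary.Negation.Core using (¬_)
open import Relation.Unary using (Pred; _∈_)

infixl 6 _+_
infixl 7 _*_
infix  4 _≈_

data ℚ[x] : Set where
  con : ℚ → ℚ[x]
  x   : (n : ℕ) .{{_ : NonZero n}} → ℚ[x]
  _+_ : Op₂ ℚ[x]
  _*_ : Op₂ ℚ[x]

-- ℚ[x] modulo _≈_ is the free commutative ℚ-algebra on the xₙ. Additive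
-- inverses need no axioms of their own: con (ℚ.- 1ℚ) * a is one of a.
data _≈_ : ℚ[x] → ℚ[x] → Set where
  ≈-refl      : ∀ {a} → a ≈ a
  ≈-sym       : ∀ {a b} → a ≈ b → b ≈ a
  ≈-trans     : ∀ {a b c} → a ≈ b → b ≈ c → a ≈ c
  +-cong      : ∀ {a b c d} → a ≈ b → c ≈ d → a + c ≈ b + d
  *-cong      : ∀ {a b c d} → a ≈ b → c ≈ d → a * c ≈ b * d
  +-assoc     : ∀ a b c → (a + b) + c ≈ a + (b + c)
  +-comm      : ∀ a b → a + b ≈ b + a
  +-identityˡ : ∀ a → con 0ℚ + a ≈ a
  *-assoc     : ∀ a b c → (a * b) * c ≈ a * (b * c)
  *-comm      : ∀ a b → a * b ≈ b * a
  *-identityˡ : ∀ a → con 1ℚ * a ≈ a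
  *-distribʳ  : ∀ a b c → (b + c) * a ≈ b * a + c * a
  *-zeroˡ     : ∀ a → con 0ℚ * a ≈ con 0ℚ
  con-+       : ∀ q r → con (q ℚ.+ r) ≈ con q + con r
  con-*       : ∀ q r → con (q ℚ.* r) ≈ con q * con r

≈-isEquivalence : IsEquivalence _≈_
≈-isEquivalence = record { refl = ≈-refl ; sym = ≈-sym ; trans = ≈-trans }

ℚ[x]-commutativeSemiring : CommutativeSemiring 0ℓ 0ℓ
ℚ[x]-commutativeSemiring = record
  { Carrier = ℚ[x]
  ; _≈_     = _≈_
  ; _+_     = _+_
  ; _*_     = _*_
  ; 0#      = con 0ℚ
  ; 1#      = con 1ℚ
  ; isCommutativeSemiring = isCommutativeSemiringˡ record
    { +-isCommutativeMonoid = record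
      { isMonoid = record
        { isSemigroup = record
          { isMagma = record { isEquivalence = ≈-isEquivalence ; ∙-cong = +-cong }
          ; assoc   = +-assoc
          }
        ; identity = +-identityˡ , λ a → ≈-trans (+-comm a _) (+-identityˡ a)
        }
      ; comm = +-comm
      }
    ; *-isCommutativeMonoid = record
      { isMonoid = record
        { isSemigroup = record
          { isMagma = record { isEquivalence = ≈-isEquivalence ; ∙-cong = *-cong }
          ; assoc   = *-assoc
          }
        ; identity = *-identityˡ , λ a → ≈-trans (*-comm a _) (*-identityˡ a)
        }
      ; comm = *-comm
      }
    ; distribʳ = *-distribʳ
    ; zeroˡ    = *-zeroˡ
    }
  }

open RawSemiringOps (CommutativeSemiring.rawSemiring ℚ[x]-commutativeSemiring) public
  using (_^_) renaming (product to ∏)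

BU : (ℓ : ℕ) .{{_ : NonZero ℓ}} → ℚ[x] → ℚ[x]
BU ℓ (con q) = con q
BU ℓ (x n)   = x (ℓ ℕ.* n) {{ℕ.m*n≢0 ℓ n}}
BU ℓ (a + b) = BU ℓ a + BU ℓ b
BU ℓ (a * b) = BU ℓ a * BU ℓ b

BU-cong : ∀ ℓ .{{_ : NonZero ℓ}} {a b} → a ≈ b → BU ℓ a ≈ BU ℓ b
BU-cong ℓ ≈-refl              = ≈-refl
BU-cong ℓ (≈-sym e)           = ≈-sym (BU-cong ℓ e)
BU-cong ℓ (≈-trans e f)       = ≈-trans (BU-cong ℓ e) (BU-cong ℓ f)
BU-cong ℓ (+-cong e f)        = +-cong (BU-cong ℓ e) (BU-cong ℓ f)
BU-cong ℓ (*-cong e f)        = *-cong (BU-cong ℓ e) (BU-cong ℓ f)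
BU-cong ℓ (+-assoc _ _ _)     = +-assoc _ _ _
BU-cong ℓ (+-comm _ _)        = +-comm _ _
BU-cong ℓ (+-identityˡ _)     = +-identityˡ _
BU-cong ℓ (*-assoc _ _ _)     = *-assoc _ _ _
BU-cong ℓ (*-comm _ _)        = *-comm _ _
BU-cong ℓ (*-identityˡ _)     = *-identityˡ _
BU-cong ℓ (*-distribʳ _ _ _)  = *-distribʳ _ _ _
BU-cong ℓ (*-zeroˡ _)         = *-zeroˡ _
BU-cong ℓ (con-+ _ _)         = con-+ _ _
BU-cong ℓ (con-* _ _)         = con-* _ _

-- An index j : Fin n stands for the integer ⟦ j ⟧ ∈ {1, …, n}.
⟦_⟧ : ∀ {n} → Fin n → ℕ
⟦ j ⟧ = suc (toℕ j)

-- elems is meant to list every element of Ω exactly once.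
module Cycles {Ω : Set} (_≟_ : DecidableEquality Ω) (elems : List Ω) where

  open DecMembership _≟_ using (_∈?_)

  -- The points of the cycle of σ through ω. A cycle has at most |Ω|
  -- points, so |Ω| iterates suffice.
  cycle : (Ω → Ω) → Ω → List Ω
  cycle σ ω = deduplicate _≟_ (iterate σ ω (length elems))

  -- All cycles of σ, each one listed once, starting at some point of it.
  cycles : (Ω → Ω) → List (List Ω)
  cycles σ = map (cycle σ) (deduplicate (λ ω ω′ → ω′ ∈? cycle σ ω) elems)

  cycleCount : (Ω → Ω) → ℕ → ℕ
  cycleCount σ ℓ = length (filter (λ c → length c ℕ.≟ ℓ) (cycles σ))

  cycleType : (Ω → Ω) → ℚ[x]
  cycleType σ = ∏ {length elems} λ j → x ⟦ j ⟧ ^ cycleCount σ ⟦ j ⟧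

IsCompleteMapping : {G : Set} → Op₂ G → (G → G) → Set
IsCompleteMapping _∙_ f = Bijective _≡_ _≡_ f × Bijective _≡_ _≡_ (λ g → f g ∙ g)

𝔽 : ℕ → Set
𝔽 p = Fin p

infix  9 𝔽[_]^_

𝔽[_]^_ : ℕ → ℕ → Set
𝔽[ p ]^ n = Vec (𝔽 p) n

_≟ᵛ_ : ∀ {p n} → DecidableEquality (𝔽[ p ]^ n)
_≟ᵛ_ = Vec.≡-dec Fin._≟_

allVectors : ∀ p n → List (𝔽[ p ]^ n)
allVectors p n = map (λ i → tabulate (finToFun {p} {n} i)) (allFin (p ℕ.^ n))

CT : ∀ {p n} → (𝔽[ p ]^ n → 𝔽[ p ]^ n) → ℚ[x]
CT {p} {n} = Cycles.cycleType _≟ᵛ_ (allVectors p n)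

module _ {p : ℕ} .{{_ : NonZero p}} where

  infixl 6 _+ᶠ_ _+ᵛ_
  infixl 7 _*ᶠ_ _·ᵛ_
  infix  8 -ᶠ_

  0ᶠ 1ᶠ : 𝔽 p
  0ᶠ = 0 mod p
  1ᶠ = 1 mod p

  _+ᶠ_ _*ᶠ_ : Op₂ (𝔽 p)
  a +ᶠ b = (toℕ a ℕ.+ toℕ b) mod p
  a *ᶠ b = (toℕ a ℕ.* toℕ b) mod p

  -ᶠ_ : 𝔽 p → 𝔽 p
  -ᶠ a = (p ∸ toℕ a) mod p

  +ᶠ-rawMonoid : RawMonoid 0ℓ 0ℓ
  +ᶠ-rawMonoid = record { Carrier = 𝔽 p ; _≈_ = _≡_ ; _∙_ = _+ᶠ_ ; ε = 0ᶠ }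

  ∑ᶠ : ∀ {n} → (Fin n → 𝔽 p) → 𝔽 p
  ∑ᶠ = RawMonoidOps.sum +ᶠ-rawMonoid

  0ᵛ : ∀ {n} → 𝔽[ p ]^ n
  0ᵛ = replicate _ 0ᶠ

  _+ᵛ_ : ∀ {n} → Op₂ (𝔽[ p ]^ n)
  _+ᵛ_ = zipWith _+ᶠ_

  _·ᵛ_ : ∀ {n} → 𝔽 p → 𝔽[ p ]^ n → 𝔽[ p ]^ n
  c ·ᵛ v = Vec.map (c *ᶠ_) v

  +ᵛ-rawMonoid : ℕ → RawMonoid 0ℓ 0ℓ
  +ᵛ-rawMonoid n = record { Carrier = 𝔽[ p ]^ n ; _≈_ = _≡_ ; _∙_ = _+ᵛ_ ; ε = 0ᵛ }

  ∑ᵛ : ∀ {m n} → (Fin m → 𝔽[ p ]^ n) → 𝔽[ p ]^ n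
  ∑ᵛ = RawMonoidOps.sum (+ᵛ-rawMonoid _)

Matrix : ℕ → ℕ → Set
Matrix p d = Fin d → Fin d → 𝔽 p

module _ {p : ℕ} .{{_ : NonZero p}} where

  infixl 7 _·ᵐ_ _*ᵐ_

  1ᵐ : ∀ {d} → Matrix p d
  1ᵐ i j with i Fin.≟ j
  ... | yes _ = 1ᶠ
  ... | no  _ = 0ᶠ

  _*ᵐ_ : ∀ {d} → Op₂ (Matrix p d)
  (M *ᵐ N) i j = ∑ᶠ λ k → M i k *ᶠ N k j

  _·ᵐ_ : ∀ {d} → 𝔽[ p ]^ d → Matrix p d → 𝔽[ p ]^ d
  v ·ᵐ M = tabulate λ j → ∑ᶠ λ i → lookup v i *ᶠ M i j

  IsEigenvalue : ∀ {d} → Matrix p d → 𝔽 p → Set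
  IsEigenvalue M c = ∃[ v ] v ≢ 0ᵛ × v ·ᵐ M ≡ c ·ᵛ v

  affine : ∀ {d} → Matrix p d → 𝔽[ p ]^ d → 𝔽[ p ]^ d → 𝔽[ p ]^ d
  affine M v u = u ·ᵐ M +ᵛ v

module _ (d p : ℕ) .{{_ : NonZero p}} where

  GL : Pred (Matrix p d) 0ℓ
  GL M = ∃[ N ] (∀ i j → (M *ᵐ N) i j ≡ 1ᵐ i j) × (∀ i j → (N *ᵐ M) i j ≡ 1ᵐ i j)

  CGL : Pred (Matrix p d) 0ℓ
  CGL M = M ∈ GL × ¬ IsEigenvalue M (-ᶠ 1ᶠ)

  AGL : Pred (𝔽[ p ]^ d → 𝔽[ p ]^ d) 0ℓ
  AGL σ = ∃[ M ] ∃[ v ] M ∈ GL × (∀ u → σ u ≡ affine M v u)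

  ACGL : Pred (𝔽[ p ]^ d → 𝔽[ p ]^ d) 0ℓ
  ACGL σ = ∃[ M ] ∃[ v ] M ∈ CGL × (∀ u → σ u ≡ affine M v u)

CT[_] : ∀ {p n} → Pred (𝔽[ p ]^ n → 𝔽[ p ]^ n) 0ℓ → Pred ℚ[x] 0ℓ
CT[ X ] γ = ∃[ σ ] σ ∈ X × γ ≈ CT σ

-- There is no constructor for ℓ ≥ 2, (d , p) = (1 , 2): that Γ is empty.
data Γ (d p ℓ : ℕ) .{{_ : NonZero p}} (γ : ℚ[x]) : Set where
  Γ-one     : ℓ ≡ 1 → γ ∈ CT[ ACGL d p ] → Γ d p ℓ γ
  Γ-generic : ℓ ≥ 2 →
              ¬ (d ≡ 1 × p ≡ 2) → ¬ (d ≡ 1 × p ≡ 3) → ¬ (d ≡ 2 × p ≡ 2) →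
              γ ∈ CT[ AGL d p ] → Γ d p ℓ γ
  Γ-1,3     : ℓ ≥ 2 → d ≡ 1 → p ≡ 3 →
              γ ≈ x 1 ^ 3 ⊎ γ ≈ x 3 → Γ d p ℓ γ
  Γ-2,2     : ℓ ≥ 2 → d ≡ 2 → p ≡ 2 →
              γ ≈ x 1 ^ 4 ⊎ γ ≈ x 2 ^ 2 ⊎ γ ≈ x 1 * x 3 → Γ d p ℓ γ

module _ {p : ℕ} .{{_ : NonZero p}} where

  record IsSubspace {n} (W : Pred (𝔽[ p ]^ n) 0ℓ) : Set where
    field
      0ᵛ∈ : 0ᵛ ∈ W
      +ᵛ∈ : ∀ {u v} → u ∈ W → v ∈ W → u +ᵛ v ∈ W
      ·ᵛ∈ : ∀ c {v} → v ∈ W → c ·ᵛ v ∈ W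

  record IsBasis {n d} (W : Pred (𝔽[ p ]^ n) 0ℓ) (b : Fin d → 𝔽[ p ]^ n) : Set where
    field
      members     : ∀ i → b i ∈ W
      independent : (c : Fin d → 𝔽 p) → ∑ᵛ (λ i → c i ·ᵛ b i) ≡ 0ᵛ → ∀ i → c i ≡ 0ᶠ
      spanning    : ∀ {w} → w ∈ W → Σ[ c ∈ (Fin d → 𝔽 p) ] w ≡ ∑ᵛ (λ i → c i ·ᵛ b i)

  HasDimension : ∀ {n} → Pred (𝔽[ p ]^ n) 0ℓ → ℕ → Set
  HasDimension {n} W d = Σ[ b ∈ (Fin d → 𝔽[ p ]^ n) ] IsBasis W b

  record IsLinear {n} (φ : 𝔽[ p ]^ n → 𝔽[ p ]^ n) : Set where
    field
      +-homo : ∀ u v → φ (u +ᵛ v) ≡ φ u +ᵛ φ v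
      ·-homo : ∀ c v → φ (c ·ᵛ v) ≡ c ·ᵛ φ v

  Coset : ∀ {n} → Pred (𝔽[ p ]^ n) 0ℓ → 𝔽[ p ]^ n → Pred (𝔽[ p ]^ n) 0ℓ
  Coset W a u = ∃[ w ] w ∈ W × u ≡ a +ᵛ w

  IsCosetwiseAffine : ∀ {n} → Pred (𝔽[ p ]^ n) 0ℓ → (𝔽[ p ]^ n → 𝔽[ p ]^ n) → Set
  IsCosetwiseAffine {n} W f =
    ∀ a → ∃[ v ] Σ[ φ ∈ (𝔽[ p ]^ n → 𝔽[ p ]^ n) ]
      IsLinear φ × (∀ {w} → w ∈ W → φ w ∈ W) ×
      (∀ {u} → u ∈ Coset W a → f u ≡ φ u +ᵛ v)

{-# OPTIONS --safe #-}
-- Choose coordinates in which W is the first factor of 𝔽[ p ]^ d × 𝔽[ p ]^ t and put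
-- f (w , y) = (α_y w , g y), where every α_y is affine without eigenvalues 0 and
-- -1. Then f is a complete mapping, and it is affine on the cosets of W. If r
-- lies on a cycle of g of length ℓ, the ℓ-th iterate of f acts on the fibre over
-- r as the product σ of the ℓ maps α_y along the cycle, so the cycles of f over
-- that cycle of g contribute BU ℓ (CT σ). It remains to write a given affine
-- permutation as a product of ℓ ≥ 2 such maps. By induction on ℓ it suffices to
-- factor an invertible M into two invertible maps without eigenvalue -1, and this
-- amounts to finding A such that A, A - 1 and A - M are invertible. Such an A is
-- assembled block by block: blocks of size 1 suffice for p ≥ 5, sizes 2 and 3 for
-- p = 3, and sizes 3, 4 and 5 for p = 2.

module Submission where

open import Defs
open import Algebra.Bundles using (AbelianGroup; CommutativeRing; CommutativeSemiring)
import Algebra.Properties.CommutativeMonoid.Sum as MonoidSum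
import Algebra.Properties.Semiring.Sum as SemiringSum
open import Data.Bool.Base using (Bool; true; false; T; not; if_then_else_)
open import Data.Bool.ListAction using (all)
open import Data.Fin.Base as Fin using (Fin; toℕ; fromℕ<; cast; punchOut; finToFun; funToFin)
open import Data.Fin.Patterns
open import Data.Fin.Properties as Fin using (toℕ-injective; toℕ-fromℕ<; toℕ<n)
open import Data.Integer.Base using (+<+)
open import Data.List.Base as List using (List; []; _∷_; map; filter; length; deduplicate; iterate; concat; concatMap; allFin; null)
import Data.List.Membership.DecPropositional as DecMembership
open import Data.List.Membership.Propositional using (find; lose) renaming (_∈_ to _∈ˡ_)
open import Data.List.Membership.Propositional.Properties
import Data.List.Properties as List
open import Data.List.Relation.Binary.Permutation.Propositional using (_↭_; prep; ↭-trans; ↭-sym; ↭-refl; ↭-reflexive)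
open import Data.List.Relation.Binary.Permutation.Propositional.Properties using (All-resp-↭; shift; ↭-length; map⁺; ∈-resp-↭)
open import Data.List.Relation.Unary.All as All using (All; []; _∷_)
import Data.List.Relation.Unary.All.Properties as All
open import Data.List.Relation.Unary.AllPairs as AllPairs using (AllPairs; []; _∷_)
import Data.List.Relation.Unary.AllPairs.Properties as AllPairs
open import Data.List.Relation.Unary.Any as Any using (Any; here; there)
import Data.List.Relation.Unary.Any.Properties as Any
open import Data.Nat.Base as ℕ using (ℕ; zero; suc; NonZero; _∸_; _≤_; _<_; z≤n; s≤s; z<s; s<s)
open import Data.Nat.DivMod
open import Data.Nat.Divisibility using (_∣_; divides; ∣⇒≤; ∣-antisym; *-monoʳ-∣; m%n≡0⇒n∣m; n∣m⇒m%n≡0)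
open import Data.Nat.Primality using (Prime; prime?; euclidsLemma; prime⇒nonTrivial; ¬prime[1])
import Data.Nat.Properties as ℕ
open import Data.Product.Base using (Σ-syntax; ∃-syntax; _×_; _,_; proj₁; proj₂)
open import Data.Rational.Base as ℚ using (ℚ; 1ℚ; Positive)
import Data.Rational.Properties as ℚ
open import Data.Sum.Base using (_⊎_; inj₁; inj₂)
open import Data.Unit.Base using (tt)
open import Data.Vec.Base as Vec using (Vec; []; _∷_; _++_; take; drop; lookup; tabulate; replicate)
import Data.Vec.Properties as Vec
open import Function.Base using (_∘_; id)
open import Function.Definitions using (Injective; Bijective)
open import Level using (0ℓ)
open import Relation.Binary.Core using (Rel)
open import Relation.Binary.Definitions using (DecidableEquality; Reflexive; Symmetric; Transitive; tri<; tri≈; tri>)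
import Relation.Binary.Definitions as Binary
open import Relation.Binary.PropositionalEquality
open import Relation.Nullary.Decidable using (Dec; yes; no; does; map′; ¬?; dec-true; dec-false; toWitness; _×-dec_; _→-dec_)
open import Relation.Nullary.Negation.Core using (¬_; contradiction)
open import Relation.Unary using (Pred; Decidable; _∈_)

-- The field 𝔽 p and its vector spaces

-- The obstacle is that every fibre map must be complete, whereas the product prescribed along a
-- cycle may have any invertible linear part. The exceptional pairs are those in which some `M`
-- admits no `A`. Over 𝔽₂ in dimension 1 nothing avoids 0 and 1. Over 𝔽₃ in dimension 1 only 2 does,
-- and it fails for `M` = 2. Over 𝔽₂ in dimension 2 only the two matrices of order 3 do, and both
-- fail for the matrix that swaps the coordinates. In the last two cases a small group of linear
-- parts is factored within itself instead, and it yields just the types listed in `Γ`. Diagonal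
-- blocks of an invertible matrix may be singular, so the statement about blocks has to hold for all
-- matrices of the given size. Over 𝔽₂ the sizes 1 and 2 are not admissible, hence 3, 4 and 5 all
-- need their own argument. Cycle types are compared through the list of periods over a set of
-- representatives of the cycles, taken up to permutation.

module _ {p : ℕ} .{{_ : NonZero p}} where

  toℕ-mod : ∀ m → toℕ (m mod p) ≡ m % p
  toℕ-mod m = toℕ-fromℕ< (m%n<n m p)

  mod-cong : ∀ {m n} → m % p ≡ n % p → m mod p ≡ n mod p
  mod-cong {m} {n} e = toℕ-injective (trans (toℕ-mod m) (trans e (sym (toℕ-mod n))))

  toℕ-% : (a : 𝔽 p) → toℕ a % p ≡ toℕ a
  toℕ-% a = m<n⇒m%n≡m (toℕ<n a)

  mod-toℕ : (a : 𝔽 p) → toℕ a mod p ≡ a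
  mod-toℕ a = toℕ-injective (trans (toℕ-mod (toℕ a)) (toℕ-% a))

  mod-+ : ∀ m n → (m mod p) +ᶠ (n mod p) ≡ (m ℕ.+ n) mod p
  mod-+ m n = mod-cong (trans (cong₂ (λ i j → (i ℕ.+ j) % p) (toℕ-mod m) (toℕ-mod n)) (sym (%-distribˡ-+ m n p)))

  mod-* : ∀ m n → (m mod p) *ᶠ (n mod p) ≡ (m ℕ.* n) mod p
  mod-* m n = mod-cong (trans (cong₂ (λ i j → (i ℕ.* j) % p) (toℕ-mod m) (toℕ-mod n)) (sym (%-distribˡ-* m n p)))

  mod-+ˡ : ∀ m (b : 𝔽 p) → (m mod p) +ᶠ b ≡ (m ℕ.+ toℕ b) mod p
  mod-+ˡ m b = trans (cong ((m mod p) +ᶠ_) (sym (mod-toℕ b))) (mod-+ m (toℕ b))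

  mod-+ʳ : ∀ (a : 𝔽 p) n → a +ᶠ (n mod p) ≡ (toℕ a ℕ.+ n) mod p
  mod-+ʳ a n = trans (cong (_+ᶠ (n mod p)) (sym (mod-toℕ a))) (mod-+ (toℕ a) n)

  mod-*ˡ : ∀ m (b : 𝔽 p) → (m mod p) *ᶠ b ≡ (m ℕ.* toℕ b) mod p
  mod-*ˡ m b = trans (cong ((m mod p) *ᶠ_) (sym (mod-toℕ b))) (mod-* m (toℕ b))

  mod-*ʳ : ∀ (a : 𝔽 p) n → a *ᶠ (n mod p) ≡ (toℕ a ℕ.* n) mod p
  mod-*ʳ a n = trans (cong (_*ᶠ (n mod p)) (sym (mod-toℕ a))) (mod-* (toℕ a) n)

  +ᶠ-comm : ∀ (a b : 𝔽 p) → a +ᶠ b ≡ b +ᶠ a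
  +ᶠ-comm a b = cong (_mod p) (ℕ.+-comm (toℕ a) (toℕ b))

  +ᶠ-assoc : ∀ (a b c : 𝔽 p) → (a +ᶠ b) +ᶠ c ≡ a +ᶠ (b +ᶠ c)
  +ᶠ-assoc a b c = trans (mod-+ˡ (toℕ a ℕ.+ toℕ b) c)
    (trans (cong (_mod p) (ℕ.+-assoc (toℕ a) (toℕ b) (toℕ c))) (sym (mod-+ʳ a (toℕ b ℕ.+ toℕ c))))

  +ᶠ-identityˡ : ∀ (a : 𝔽 p) → 0ᶠ +ᶠ a ≡ a
  +ᶠ-identityˡ a = trans (mod-+ˡ 0 a) (mod-toℕ a)

  +ᶠ-inverseʳ : ∀ (a : 𝔽 p) → a +ᶠ (-ᶠ a) ≡ 0ᶠ
  +ᶠ-inverseʳ a = trans (mod-+ʳ a (p ∸ toℕ a))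
    (mod-cong {n = 0} (trans (cong (_% p) (ℕ.m+[n∸m]≡n (ℕ.<⇒≤ (toℕ<n a)))) (trans (n%n≡0 p) (sym (m*n%n≡0 0 p)))))

  *ᶠ-comm : ∀ (a b : 𝔽 p) → a *ᶠ b ≡ b *ᶠ a
  *ᶠ-comm a b = cong (_mod p) (ℕ.*-comm (toℕ a) (toℕ b))

  *ᶠ-assoc : ∀ (a b c : 𝔽 p) → (a *ᶠ b) *ᶠ c ≡ a *ᶠ (b *ᶠ c)
  *ᶠ-assoc a b c = trans (mod-*ˡ (toℕ a ℕ.* toℕ b) c)
    (trans (cong (_mod p) (ℕ.*-assoc (toℕ a) (toℕ b) (toℕ c))) (sym (mod-*ʳ a (toℕ b ℕ.* toℕ c))))

  *ᶠ-identityˡ : ∀ (a : 𝔽 p) → 1ᶠ *ᶠ a ≡ a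
  *ᶠ-identityˡ a = trans (mod-*ˡ 1 a) (trans (cong (_mod p) (ℕ.*-identityˡ (toℕ a))) (mod-toℕ a))

  *ᶠ-distribˡ : ∀ (a b c : 𝔽 p) → a *ᶠ (b +ᶠ c) ≡ a *ᶠ b +ᶠ a *ᶠ c
  *ᶠ-distribˡ a b c = trans (mod-*ʳ a (toℕ b ℕ.+ toℕ c))
    (trans (cong (_mod p) (ℕ.*-distribˡ-+ (toℕ a) (toℕ b) (toℕ c))) (sym (mod-+ (toℕ a ℕ.* toℕ b) (toℕ a ℕ.* toℕ c))))

  𝔽-commutativeRing : CommutativeRing 0ℓ 0ℓ
  𝔽-commutativeRing = record
    { Carrier = 𝔽 p ; _≈_ = _≡_ ; _+_ = _+ᶠ_ ; _*_ = _*ᶠ_ ; -_ = -ᶠ_ ; 0# = 0ᶠ ; 1# = 1ᶠ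
    ; isCommutativeRing = record
      { isRing = record
        { +-isAbelianGroup = record
          { isGroup = record
            { isMonoid = record
              { isSemigroup = record
                { isMagma = record { isEquivalence = isEquivalence ; ∙-cong = cong₂ _+ᶠ_ }
                ; assoc = +ᶠ-assoc }
              ; identity = +ᶠ-identityˡ , λ a → trans (+ᶠ-comm a 0ᶠ) (+ᶠ-identityˡ a) }
            ; inverse = (λ a → trans (+ᶠ-comm (-ᶠ a) a) (+ᶠ-inverseʳ a)) , +ᶠ-inverseʳ
            ; ⁻¹-cong = cong -ᶠ_ }
          ; comm = +ᶠ-comm }
        ; *-cong = cong₂ _*ᶠ_
        ; *-assoc = *ᶠ-assoc
        ; *-identity = *ᶠ-identityˡ , λ a → trans (*ᶠ-comm a 1ᶠ) (*ᶠ-identityˡ a)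
        ; distrib = *ᶠ-distribˡ
                  , λ a b c → trans (*ᶠ-comm (b +ᶠ c) a) (trans (*ᶠ-distribˡ a b c) (cong₂ _+ᶠ_ (*ᶠ-comm a b) (*ᶠ-comm a c)))
        }
      ; *-comm = *ᶠ-comm } }

  module 𝔽ᵣ = CommutativeRing 𝔽-commutativeRing

  -ᵛ_ : ∀ {n} → 𝔽[ p ]^ n → 𝔽[ p ]^ n
  -ᵛ_ = Vec.map (-ᶠ_)

  +ᵛ-abelianGroup : ℕ → AbelianGroup 0ℓ 0ℓ
  +ᵛ-abelianGroup n = record
    { Carrier = 𝔽[ p ]^ n ; _≈_ = _≡_ ; _∙_ = _+ᵛ_ ; ε = 0ᵛ ; _⁻¹ = -ᵛ_
    ; isAbelianGroup = record
      { isGroup = record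
        { isMonoid = record
          { isSemigroup = record
            { isMagma = record { isEquivalence = isEquivalence ; ∙-cong = cong₂ _+ᵛ_ }
            ; assoc = Vec.zipWith-assoc +ᶠ-assoc }
          ; identity = Vec.zipWith-identityˡ +ᶠ-identityˡ , Vec.zipWith-identityʳ 𝔽ᵣ.+-identityʳ }
        ; inverse = Vec.zipWith-inverseˡ 𝔽ᵣ.-‿inverseˡ , Vec.zipWith-inverseʳ +ᶠ-inverseʳ
        ; ⁻¹-cong = cong -ᵛ_ }
      ; comm = Vec.zipWith-comm +ᶠ-comm } }

  module 𝔽ᵥ {n : ℕ} = AbelianGroup (+ᵛ-abelianGroup n)
  module 𝔽ᵥₚ {n : ℕ} where
    open import Algebra.Properties.AbelianGroup (+ᵛ-abelianGroup n) public
    open import Algebra.Properties.CommutativeSemigroup (AbelianGroup.commutativeSemigroup (+ᵛ-abelianGroup n)) public using (interchange)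

  ·ᵛ-distribˡ : ∀ {n} c (u v : 𝔽[ p ]^ n) → c ·ᵛ (u +ᵛ v) ≡ c ·ᵛ u +ᵛ c ·ᵛ v
  ·ᵛ-distribˡ c [] [] = refl
  ·ᵛ-distribˡ c (a ∷ u) (b ∷ v) = cong₂ _∷_ (*ᶠ-distribˡ c a b) (·ᵛ-distribˡ c u v)

  ·ᵛ-distribʳ : ∀ {n} b c (u : 𝔽[ p ]^ n) → (b +ᶠ c) ·ᵛ u ≡ b ·ᵛ u +ᵛ c ·ᵛ u
  ·ᵛ-distribʳ b c [] = refl
  ·ᵛ-distribʳ b c (a ∷ u) = cong₂ _∷_ (𝔽ᵣ.distribʳ a b c) (·ᵛ-distribʳ b c u)

  ·ᵛ-assoc : ∀ {n} b c (u : 𝔽[ p ]^ n) → (b *ᶠ c) ·ᵛ u ≡ b ·ᵛ (c ·ᵛ u)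
  ·ᵛ-assoc b c [] = refl
  ·ᵛ-assoc b c (a ∷ u) = cong₂ _∷_ (*ᶠ-assoc b c a) (·ᵛ-assoc b c u)

  ·ᵛ-comm : ∀ {n} b c (u : 𝔽[ p ]^ n) → b ·ᵛ (c ·ᵛ u) ≡ c ·ᵛ (b ·ᵛ u)
  ·ᵛ-comm b c u = trans (sym (·ᵛ-assoc b c u)) (trans (cong (_·ᵛ u) (*ᶠ-comm b c)) (·ᵛ-assoc c b u))

  ·ᵛ-identity : ∀ {n} (u : 𝔽[ p ]^ n) → 1ᶠ ·ᵛ u ≡ u
  ·ᵛ-identity [] = refl
  ·ᵛ-identity (a ∷ u) = cong₂ _∷_ (*ᶠ-identityˡ a) (·ᵛ-identity u)

  ·ᵛ-zeroˡ : ∀ {n} (u : 𝔽[ p ]^ n) → 0ᶠ ·ᵛ u ≡ 0ᵛ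
  ·ᵛ-zeroˡ [] = refl
  ·ᵛ-zeroˡ (a ∷ u) = cong₂ _∷_ (𝔽ᵣ.zeroˡ a) (·ᵛ-zeroˡ u)

  ·ᵛ-zeroʳ : ∀ {n} c → c ·ᵛ 0ᵛ {p} {n} ≡ 0ᵛ
  ·ᵛ-zeroʳ {n} c = trans (Vec.map-replicate (c *ᶠ_) 0ᶠ n) (cong (replicate n) (𝔽ᵣ.zeroʳ c))

  -1·ᵛ : ∀ {n} (u : 𝔽[ p ]^ n) → (-ᶠ 1ᶠ) ·ᵛ u ≡ -ᵛ u
  -1·ᵛ u = 𝔽ᵥₚ.inverseʳ-unique u ((-ᶠ 1ᶠ) ·ᵛ u) (trans (cong (_+ᵛ (-ᶠ 1ᶠ) ·ᵛ u) (sym (·ᵛ-identity u)))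
    (trans (sym (·ᵛ-distribʳ 1ᶠ (-ᶠ 1ᶠ) u)) (trans (cong (_·ᵛ u) (+ᶠ-inverseʳ 1ᶠ)) (·ᵛ-zeroˡ u))))

  +ᵛ-++ : ∀ {m n} (u u′ : 𝔽[ p ]^ m) (w w′ : 𝔽[ p ]^ n) → (u ++ w) +ᵛ (u′ ++ w′) ≡ (u +ᵛ u′) ++ (w +ᵛ w′)
  +ᵛ-++ u u′ w w′ = Vec.zipWith-++ _+ᶠ_ u w u′ w′

  0ᵛ-++ : ∀ m {n} → 0ᵛ {p} {m} ++ 0ᵛ {p} {n} ≡ 0ᵛ
  0ᵛ-++ zero = refl
  0ᵛ-++ (suc m) = cong (0ᶠ ∷_) (0ᵛ-++ m)

-- Linear maps

record Lin (p : ℕ) .{{_ : NonZero p}} (m n : ℕ) : Set where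
  field
    ap    : 𝔽[ p ]^ m → 𝔽[ p ]^ n
    ap-+  : ∀ u v → ap (u +ᵛ v) ≡ ap u +ᵛ ap v
    ap-·  : ∀ c v → ap (c ·ᵛ v) ≡ c ·ᵛ ap v

  ap-0 : ap 0ᵛ ≡ 0ᵛ
  ap-0 = trans (cong ap (sym (·ᵛ-zeroˡ 0ᵛ))) (trans (ap-· 0ᶠ 0ᵛ) (·ᵛ-zeroˡ _))

  ap-neg : ∀ v → ap (-ᵛ v) ≡ -ᵛ (ap v)
  ap-neg v = trans (cong ap (sym (-1·ᵛ v))) (trans (ap-· (-ᶠ 1ᶠ) v) (-1·ᵛ (ap v)))

open Lin public

module _ {p : ℕ} .{{_ : NonZero p}} where

  TrivialKernel : ∀ {m n} → Lin p m n → Set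
  TrivialKernel f = ∀ u → ap f u ≡ 0ᵛ → u ≡ 0ᵛ

  u-v≡0⇒u≡v : ∀ {n} {u v : 𝔽[ p ]^ n} → u +ᵛ (-ᵛ v) ≡ 0ᵛ → u ≡ v
  u-v≡0⇒u≡v {u = u} {v} e = trans (𝔽ᵥₚ.inverseˡ-unique u (-ᵛ v) e) (𝔽ᵥₚ.⁻¹-involutive v)

  trivialKernel⇒injective : ∀ {m n} (f : Lin p m n) → TrivialKernel f → Injective _≡_ _≡_ (ap f)
  trivialKernel⇒injective f tk {u} {v} e = u-v≡0⇒u≡v (tk _ (trans (ap-+ f u (-ᵛ v))
    (trans (cong₂ _+ᵛ_ e (ap-neg f v)) (𝔽ᵥ.inverseʳ (ap f v)))))

  idˡ : ∀ {n} → Lin p n n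
  idˡ = record { ap = id ; ap-+ = λ _ _ → refl ; ap-· = λ _ _ → refl }

  infixr 9 _∘ˡ_
  infixl 6 _+ˡ_

  _∘ˡ_ : ∀ {l m n} → Lin p m n → Lin p l m → Lin p l n
  f ∘ˡ g = record
    { ap = ap f ∘ ap g
    ; ap-+ = λ u v → trans (cong (ap f) (ap-+ g u v)) (ap-+ f _ _)
    ; ap-· = λ c v → trans (cong (ap f) (ap-· g c v)) (ap-· f c (ap g v)) }

  _+ˡ_ : ∀ {m n} → Lin p m n → Lin p m n → Lin p m n
  f +ˡ g = record
    { ap = λ u → ap f u +ᵛ ap g u
    ; ap-+ = λ u v → trans (cong₂ _+ᵛ_ (ap-+ f u v) (ap-+ g u v)) (𝔽ᵥₚ.interchange _ _ _ _)
    ; ap-· = λ c v → trans (cong₂ _+ᵛ_ (ap-· f c v) (ap-· g c v)) (sym (·ᵛ-distribˡ c (ap f v) (ap g v))) }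

  scaleˡ : ∀ {n} → 𝔽 p → Lin p n n
  scaleˡ a = record
    { ap = a ·ᵛ_
    ; ap-+ = ·ᵛ-distribˡ a
    ; ap-· = λ c v → ·ᵛ-comm a c v }

  pairˡ : ∀ {l m n} → Lin p l m → Lin p l n → Lin p l (m ℕ.+ n)
  pairˡ f g = record
    { ap = λ u → ap f u ++ ap g u
    ; ap-+ = λ u v → trans (cong₂ _++_ (ap-+ f u v) (ap-+ g u v)) (sym (+ᵛ-++ (ap f u) (ap f v) _ _))
    ; ap-· = λ c v → trans (cong₂ _++_ (ap-· f c v) (ap-· g c v)) (sym (Vec.map-++ _ (ap f v) _)) }

  takeˡ : ∀ m {n} → Lin p (m ℕ.+ n) m
  takeˡ m = record
    { ap = take m
    ; ap-+ = λ u v → Vec.take-zipWith _+ᶠ_ u v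
    ; ap-· = λ c v → Vec.take-map (c *ᶠ_) m v }

  dropˡ : ∀ m {n} → Lin p (m ℕ.+ n) n
  dropˡ m = record
    { ap = drop m
    ; ap-+ = λ u v → Vec.drop-zipWith _+ᶠ_ u v
    ; ap-· = λ c v → Vec.drop-map (c *ᶠ_) m v }

  take-++ : ∀ {m n} (u : 𝔽[ p ]^ m) (w : 𝔽[ p ]^ n) → take m (u ++ w) ≡ u
  take-++ {m} u w = Vec.++-injectiveˡ (take m (u ++ w)) u (Vec.take++drop≡id m (u ++ w))

  drop-++ : ∀ {m n} (u : 𝔽[ p ]^ m) (w : 𝔽[ p ]^ n) → drop m (u ++ w) ≡ w
  drop-++ {m} u w = Vec.++-injectiveʳ (take m (u ++ w)) u (Vec.take++drop≡id m (u ++ w))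

-- Finiteness
fin-injective⇒surjective : ∀ {n} (f : Fin n → Fin n) → Injective _≡_ _≡_ f → ∀ y → ∃[ i ] f i ≡ y
fin-injective⇒surjective {suc n} f inj y with Fin.any? (λ i → f i Fin.≟ y)
... | yes found = found
... | no  none  = contradiction
  (Fin.injective⇒≤ {f = λ i → punchOut {i = y} {f i} λ e → none (i , sym e)}
    λ e → inj (Fin.punchOut-injective {i = y} _ _ e))
  ℕ.1+n≰n

encode : ∀ {p n} → 𝔽[ p ]^ n → Fin (p ℕ.^ n)
encode v = funToFin (lookup v)

decode : ∀ {p} n → Fin (p ℕ.^ n) → 𝔽[ p ]^ n
decode {p} n i = tabulate (finToFun {p} {n} i)

decode-encode : ∀ {p n} (v : 𝔽[ p ]^ n) → decode n (encode v) ≡ v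
decode-encode v = trans (Vec.tabulate-cong (Fin.finToFun-funToFin (lookup v))) (Vec.tabulate∘lookup v)

funToFin-cong : ∀ {m n} {f g : Fin m → Fin n} → f ≗ g → funToFin f ≡ funToFin g
funToFin-cong {zero}  e = refl
funToFin-cong {suc m} e = cong₂ Fin.combine (e Fin.zero) (funToFin-cong (e ∘ Fin.suc))

encode-decode : ∀ {p} n (i : Fin (p ℕ.^ n)) → encode (decode n i) ≡ i
encode-decode {p} n i = trans (funToFin-cong (Vec.lookup∘tabulate (finToFun {p} {n} i))) (Fin.funToFin-finToFin {n} {p} i)

encode-injective : ∀ {p n} {u v : 𝔽[ p ]^ n} → encode u ≡ encode v → u ≡ v
encode-injective {u = u} {v} e = trans (sym (decode-encode u)) (trans (cong (decode _) e) (decode-encode v))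

decode-injective : ∀ {p} n {i j : Fin (p ℕ.^ n)} → decode n i ≡ decode n j → i ≡ j
decode-injective n {i} {j} e = trans (sym (encode-decode n i)) (trans (cong encode e) (encode-decode n j))

injective⇒onto : ∀ {p n} (f : 𝔽[ p ]^ n → 𝔽[ p ]^ n) → Injective _≡_ _≡_ f → ∀ y → ∃[ u ] f u ≡ y
injective⇒onto {n = n} f inj y
  with i , e ← fin-injective⇒surjective (encode ∘ f ∘ decode n) (decode-injective n ∘ inj ∘ encode-injective) (encode y)
  = decode n i , encode-injective e

injective⇒bijective : ∀ {p n} {f : 𝔽[ p ]^ n → 𝔽[ p ]^ n} → Injective _≡_ _≡_ f → Bijective _≡_ _≡_ f
injective⇒bijective {f = f} inj = inj , λ y → let u , e = injective⇒onto f inj y in u , λ { refl → e }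

-- Inverses modulo a prime

module _ {p : ℕ} .{{_ : NonZero p}} (p-prime : Prime p) where

  toℕ-0ᶠ : toℕ (0ᶠ {p}) ≡ 0
  toℕ-0ᶠ = trans (toℕ-mod 0) (m*n%n≡0 0 p)

  p∣toℕ⇒≡0ᶠ : ∀ (a : 𝔽 p) → p ∣ toℕ a → a ≡ 0ᶠ
  p∣toℕ⇒≡0ᶠ a p∣a = toℕ-injective (trans (sym (toℕ-% a)) (trans (n∣m⇒m%n≡0 (toℕ a) p p∣a) (sym toℕ-0ᶠ)))

  *ᶠ-zero-divisor-free : ∀ (a b : 𝔽 p) → a ≢ 0ᶠ → a *ᶠ b ≡ 0ᶠ → b ≡ 0ᶠ
  *ᶠ-zero-divisor-free a b a≢0 e
    with euclidsLemma (toℕ a) (toℕ b) p-prime (m%n≡0⇒n∣m _ p (trans (sym (toℕ-mod (toℕ a ℕ.* toℕ b))) (trans (cong toℕ e) toℕ-0ᶠ)))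
  ... | inj₁ p∣a = contradiction (p∣toℕ⇒≡0ᶠ a p∣a) a≢0
  ... | inj₂ p∣b = p∣toℕ⇒≡0ᶠ b p∣b

  -- Multiplication by `a` is injective on a finite set, so it attains the value 1.
  *ᶠ-inverse : ∀ (a : 𝔽 p) → a ≢ 0ᶠ → ∃[ b ] a *ᶠ b ≡ 1ᶠ
  *ᶠ-inverse a a≢0 = fin-injective⇒surjective (a *ᶠ_)
    (λ {b} {c} e → trans (inverseˡ-unique b (-ᶠ c)
        (*ᶠ-zero-divisor-free a _ a≢0 (trans (*ᶠ-distribˡ a b (-ᶠ c))
          (trans (cong₂ _+ᶠ_ e (sym (-‿distribʳ-* a c))) (+ᶠ-inverseʳ (a *ᶠ c))))))
      (-‿involutive c)) 1ᶠ
    where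
    open import Algebra.Properties.Ring 𝔽ᵣ.ring using (-‿distribʳ-*; -‿involutive)
    open import Algebra.Properties.Group 𝔽ᵣ.+-group using (inverseˡ-unique)

-- Linear maps given by rows, and extension of independent families

module _ {p : ℕ} .{{_ : NonZero p}} where

  zeroˡ : ∀ {m n} → Lin p m n
  zeroˡ = record
    { ap   = λ _ → 0ᵛ
    ; ap-+ = λ _ _ → sym (𝔽ᵥ.identityˡ 0ᵛ)
    ; ap-· = λ c _ → sym (·ᵛ-zeroʳ c) }

  consˡ : ∀ {m n} → 𝔽[ p ]^ n → Lin p m n → Lin p (suc m) n
  consˡ b f = record
    { ap   = λ { (c ∷ u) → c ·ᵛ b +ᵛ ap f u }
    ; ap-+ = λ { (c ∷ u) (c′ ∷ u′) → trans (cong₂ _+ᵛ_ (·ᵛ-distribʳ c c′ b) (ap-+ f u u′)) (𝔽ᵥₚ.interchange (c ·ᵛ b) (c′ ·ᵛ b) (ap f u) (ap f u′)) }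
    ; ap-· = λ { a (c ∷ u) → trans (cong₂ _+ᵛ_ (·ᵛ-assoc a c b) (ap-· f a u)) (sym (·ᵛ-distribˡ a (c ·ᵛ b) (ap f u))) } }

  comb : ∀ {m n} → Vec (𝔽[ p ]^ n) m → Lin p m n
  comb []       = zeroˡ
  comb (b ∷ bs) = consˡ b (comb bs)

  comb-∑ : ∀ {m n} (b : Fin m → 𝔽[ p ]^ n) (c : Fin m → 𝔽 p) →
           ap (comb (tabulate b)) (tabulate c) ≡ ∑ᵛ (λ i → c i ·ᵛ b i)
  comb-∑ {zero}  b c = refl
  comb-∑ {suc m} b c = cong (c Fin.zero ·ᵛ b Fin.zero +ᵛ_) (comb-∑ (b ∘ Fin.suc) (c ∘ Fin.suc))

  0∷ˡ : ∀ {n} → Lin p n (suc n)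
  0∷ˡ = record
    { ap   = 0ᶠ ∷_
    ; ap-+ = λ u v → cong (_∷ u +ᵛ v) (sym (+ᶠ-identityˡ 0ᶠ))
    ; ap-· = λ c v → cong (_∷ c ·ᵛ v) (sym (𝔽ᵣ.zeroʳ c)) }

  rows : ∀ {m n} → Lin p m n → Vec (𝔽[ p ]^ n) m
  rows {zero}  f = []
  rows {suc m} f = ap f (1ᶠ ∷ 0ᵛ) ∷ rows (f ∘ˡ 0∷ˡ)

  comb-rows : ∀ {m n} (f : Lin p m n) u → ap (comb (rows f)) u ≡ ap f u
  comb-rows f []      = sym (ap-0 f)
  comb-rows f (c ∷ u) = trans (cong₂ _+ᵛ_ (sym (ap-· f c (1ᶠ ∷ 0ᵛ))) (comb-rows (f ∘ˡ 0∷ˡ) u))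
    (trans (sym (ap-+ f (c ·ᵛ (1ᶠ ∷ 0ᵛ)) (0ᶠ ∷ u)))
      (cong (ap f) (cong₂ _∷_ (trans (cong (_+ᶠ 0ᶠ) (𝔽ᵣ.*-identityʳ c)) (𝔽ᵣ.+-identityʳ c))
        (trans (cong (_+ᵛ u) (·ᵛ-zeroʳ c)) (𝔽ᵥ.identityˡ u)))))

  any-vector? : ∀ {n ℓ} {P : 𝔽[ p ]^ n → Set ℓ} → Decidable P → Dec (∃[ u ] P u)
  any-vector? {n} {P = P} P? = map′ (λ (i , Pi) → decode n i , Pi) (λ (u , Pu) → encode u , subst P (sym (decode-encode u)) Pu)
    (Fin.any? (P? ∘ decode n))

  module _ (p-prime : Prime p) where

    -- A relation in which `b` has a coefficient `c ≢ 0ᶠ` could be solved for `b`, which would put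
    -- `b` into the image of `f`.
    consˡ-trivialKernel : ∀ {m n} b (f : Lin p m n) → TrivialKernel f → (∀ u → ap f u ≢ b) → TrivialKernel (consˡ b f)
    consˡ-trivialKernel b f tk b∉ (c ∷ u) e with c Fin.≟ 0ᶠ
    ... | yes refl = cong (0ᶠ ∷_) (tk u (trans (sym (𝔽ᵥ.identityˡ (ap f u))) (trans (cong (_+ᵛ ap f u) (sym (·ᵛ-zeroˡ b))) e)))
    ... | no  c≢0 with c⁻¹ , cc⁻¹≡1 ← *ᶠ-inverse p-prime c c≢0 = contradiction
      (trans (ap-· f c⁻¹ (-ᵛ u)) (trans (cong (c⁻¹ ·ᵛ_) (trans (ap-neg f u) (sym (𝔽ᵥₚ.inverseˡ-unique (c ·ᵛ b) (ap f u) e))))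
        (trans (sym (·ᵛ-assoc c⁻¹ c b)) (trans (cong (_·ᵛ b) (trans (*ᶠ-comm c⁻¹ c) cc⁻¹≡1)) (·ᵛ-identity b)))))
      (b∉ (c⁻¹ ·ᵛ (-ᵛ u)))

    -- Counting: if every vector were attained, a choice of preimages would inject a set of `p ^ n`
    -- elements into one of `p ^ m`.
    outside-image : ∀ {m n} (f : 𝔽[ p ]^ m → 𝔽[ p ]^ n) → m < n → ∃[ v ] ∀ u → f u ≢ v
    outside-image {m} {n} f m<n
      with i , ¬Pi ← Fin.¬∀⟶∃¬ (p ℕ.^ n) (λ i → ∃[ u ] f u ≡ decode n i) (λ i → any-vector? λ u → f u ≟ᵛ decode n i)
        (λ onto → ℕ.<⇒≱ (ℕ.^-monoʳ-< p (ℕ.nonTrivial⇒n>1 p {{prime⇒nonTrivial p-prime}}) m<n)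
          (Fin.injective⇒≤ {f = λ i → encode (proj₁ (onto i))} λ {i} {j} e →
            decode-injective n (trans (sym (proj₂ (onto i))) (trans (cong f (encode-injective e)) (proj₂ (onto j))))))
      = decode n i , λ u e → ¬Pi (u , e)

    -- Each round adds a vector outside the current image. New vectors go in front, so the
    -- coordinates of `f` stay at the end, behind `k` zeros.
    extend : ∀ k {m n} (f : Lin p m n) → TrivialKernel f → k ℕ.+ m ≤ n →
             Σ[ h ∈ Lin p (k ℕ.+ m) n ] TrivialKernel h × (∀ u → ap h (0ᵛ {n = k} ++ u) ≡ ap f u)
    extend zero    f tk _ = f , tk , λ _ → refl
    extend (suc k) f tk k+m<n
      with h , tk-h , eq ← extend k f tk (ℕ.<⇒≤ k+m<n)
      with v , v∉ ← outside-image (ap h) k+m<n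
      = consˡ v h , consˡ-trivialKernel v h tk-h v∉
      , λ u → trans (cong₂ _+ᵛ_ (·ᵛ-zeroˡ v) (eq u)) (𝔽ᵥ.identityˡ (ap f u))

  -- Exhaustive search for a matrix at invertible distance from R

  -- Triviality of the kernel of the difference, phrased without subtraction; for `h` = `zeroˡ` it
  -- is `TrivialKernel f`.
  AgreeOnlyAt0 : ∀ {m n} → Lin p m n → Lin p m n → Set
  AgreeOnlyAt0 f h = ∀ u → ap f u ≡ ap h u → u ≡ 0ᵛ

  infixl 6 _⊝_

  _⊝_ : ∀ {n} → 𝔽[ p ]^ n → 𝔽[ p ]^ n → 𝔽[ p ]^ n
  a ⊝ r = a +ᵛ (-ᵛ r)

  module Search {n : ℕ} (vectors : List (𝔽[ p ]^ n)) (scalars : List (𝔽 p)) where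

    Row : Set
    Row = 𝔽[ p ]^ n

    unconsRow : ∀ {m} {X : Set} → X × Vec Row (suc m) → (X × Row) × Vec Row m
    unconsRow (tag , a ∷ as) = (tag , a) , as

    -- A state is a candidate whose rows considered so far differ from those of R
    -- by independent vectors, together with the list of all their combinations.
    step : ∀ {X : Set} → Row → (X × Row) × List Row → List (X × List Row)
    step r ((tag , a) , S) = if does (DecMembership._∈?_ _≟ᵛ_ (a ⊝ r) S) then [] else
      (tag , concatMap (λ c → List.map ((c ·ᵛ (a ⊝ r)) +ᵛ_) S) scalars) ∷ []

    -- Matrices `R` are treated from the last row upwards: `unconsRow` stores the head rows in the
    -- tag, and the continuation gives one of them back at each level. All `R` with the same lower
    -- rows share the surviving states, so a candidate spoilt by those rows is dropped for all of
    -- them at once.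
    search : ∀ m {X : Set} → List (X × Vec Row m) → (List (X × List Row) → Bool) → Bool
    search zero    cands k = k (List.map (λ (tag , _) → tag , 0ᵛ ∷ []) cands)
    search (suc m) cands k = search m (List.map unconsRow cands)
      λ states → all (λ r → k (concatMap (step r) states)) vectors

    covers : List (Vec Row n) → Bool
    covers cands = search n (List.map (tt ,_) cands) (not ∘ null)

  _-ˡ_ : ∀ {m n} → Lin p m n → Lin p m n → Lin p m n
  f -ˡ h = f +ˡ (scaleˡ (-ᶠ 1ᶠ) ∘ˡ h)

  ap--ˡ : ∀ {m n} (f h : Lin p m n) u → ap (f -ˡ h) u ≡ ap f u ⊝ ap h u
  ap--ˡ f h u = cong (ap f u +ᵛ_) (-1·ᵛ (ap h u))

  agreeOnlyAt0⇒trivialKernel : ∀ {m n} (f h : Lin p m n) → AgreeOnlyAt0 f h → TrivialKernel (f -ˡ h)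
  agreeOnlyAt0⇒trivialKernel f h ag u e = ag u (u-v≡0⇒u≡v (trans (sym (ap--ˡ f h u)) e))

  trivialKernel⇒agreeOnlyAt0 : ∀ {m n} (f h : Lin p m n) → TrivialKernel (f -ˡ h) → AgreeOnlyAt0 f h
  trivialKernel⇒agreeOnlyAt0 f h tk u e = tk u (trans (ap--ˡ f h u) (trans (cong (_⊝ ap h u) e) (𝔽ᵥ.inverseʳ (ap h u))))

  consˡ-⊝ : ∀ {m n} a r (f h : Lin p m n) u → ap (consˡ a f) u ⊝ ap (consˡ r h) u ≡ ap (consˡ (a ⊝ r) (f -ˡ h)) u
  consˡ-⊝ a r f h (c ∷ u) = begin
    (c ·ᵛ a +ᵛ ap f u) ⊝ (c ·ᵛ r +ᵛ ap h u)             ≡⟨ cong ((c ·ᵛ a +ᵛ ap f u) +ᵛ_) (sym (𝔽ᵥₚ.⁻¹-∙-comm (c ·ᵛ r) (ap h u))) ⟩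
    (c ·ᵛ a +ᵛ ap f u) +ᵛ ((-ᵛ (c ·ᵛ r)) +ᵛ (-ᵛ ap h u)) ≡⟨ 𝔽ᵥₚ.interchange (c ·ᵛ a) (ap f u) (-ᵛ (c ·ᵛ r)) (-ᵛ ap h u) ⟩
    (c ·ᵛ a ⊝ c ·ᵛ r) +ᵛ (ap f u ⊝ ap h u)              ≡⟨ cong₂ _+ᵛ_ (cong (c ·ᵛ a +ᵛ_) (sym (ap-neg (scaleˡ c) r))) (sym (ap--ˡ f h u)) ⟩
    (c ·ᵛ a +ᵛ c ·ᵛ (-ᵛ r)) +ᵛ ap (f -ˡ h) u             ≡⟨ cong (_+ᵛ ap (f -ˡ h) u) (sym (·ᵛ-distribˡ c a (-ᵛ r))) ⟩
    c ·ᵛ (a ⊝ r) +ᵛ ap (f -ˡ h) u                       ∎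
    where open ≡-Reasoning

  ∈-allVectors : ∀ {n} (v : 𝔽[ p ]^ n) → v ∈ˡ allVectors p n
  ∈-allVectors {n} v = subst (_∈ˡ allVectors p n) (decode-encode v) (∈-map⁺ (decode n) (∈-allFin (encode v)))

  module SearchSound (p-prime : Prime p) {n : ℕ} where
    open Search {n} (allVectors p n) (allFin p)

    -- The invariant of the search. It suffices that `S` contains all combinations of the row
    -- differences: a new difference outside `S` is then outside their span and keeps the rows
    -- independent.
    Valid : ∀ {m} {X : Set} → List (X × Vec Row m) → Vec Row m → X × List Row → Set
    Valid cands R (tag , S) = Σ[ as ∈ Vec Row _ ] (tag , as) ∈ˡ cands × AgreeOnlyAt0 (comb as) (comb R)
                            × (∀ u → ap (comb as) u ⊝ ap (comb R) u ∈ˡ S)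

    step-valid : ∀ {m} {X : Set} (cands : List (X × Vec Row (suc m))) r (R : Vec Row m) s {s′} →
                 Valid (List.map unconsRow cands) R s →
                 s′ ∈ˡ step r s → Valid cands (r ∷ R) s′
    step-valid cands r R ((tag , a) , S) (as , mem , ag , sp) s′∈
      with DecMembership._∈?_ _≟ᵛ_ (a ⊝ r) S | ∈-map⁻ unconsRow mem
    step-valid cands r R ((tag , a) , S) (as , mem , ag , sp) () | yes _ | _
    step-valid cands r R ((tag , a) , S) (as , mem , ag , sp) (here refl) | no a⊝r∉ | (tag , a ∷ as) , mem′ , refl
      = a ∷ as , mem′
      , trivialKernel⇒agreeOnlyAt0 (comb (a ∷ as)) (comb (r ∷ R)) (λ u e →
          consˡ-trivialKernel p-prime (a ⊝ r) (comb as -ˡ comb R) (agreeOnlyAt0⇒trivialKernel (comb as) (comb R) ag)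
            (λ v e′ → a⊝r∉ (subst (_∈ˡ S) (trans (sym (ap--ˡ (comb as) (comb R) v)) e′) (sp v)))
            u (trans (sym (consˡ-⊝ a r (comb as) (comb R) u)) (trans (sym (ap--ˡ (comb (a ∷ as)) (comb (r ∷ R)) u)) e)))
      , λ { (c ∷ u) → subst (_∈ˡ concatMap (λ c → List.map ((c ·ᵛ (a ⊝ r)) +ᵛ_) S) (allFin p))
              (sym (trans (consˡ-⊝ a r (comb as) (comb R) (c ∷ u)) (cong (c ·ᵛ (a ⊝ r) +ᵛ_) (ap--ˡ (comb as) (comb R) u))))
              (∈-concatMap⁺ (λ c → List.map ((c ·ᵛ (a ⊝ r)) +ᵛ_) S) (lose (∈-allFin c) (∈-map⁺ (c ·ᵛ (a ⊝ r) +ᵛ_) (sp u)))) }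

    -- The Boolean check runs over every choice of rows. The rows of the given `R` single out one
    -- branch, whose final states satisfy `k` and are valid for `R`.
    search-sound : ∀ m {X : Set} (cands : List (X × Vec Row m)) k → T (search m cands k) → (R : Vec Row m) →
                   ∃[ states ] T (k states) × (∀ {s} → s ∈ˡ states → Valid cands R s)
    search-sound zero cands k ok [] = _ , ok , λ s∈ → base (∈-map⁻ _ s∈)
      where
      base : ∀ {s} → ∃[ c ] c ∈ˡ cands × s ≡ (proj₁ c , 0ᵛ ∷ []) → Valid cands [] s
      base ((tag , []) , c∈ , refl) = [] , c∈ , (λ { [] _ → refl }) , λ { [] → here (𝔽ᵥ.inverseʳ 0ᵛ) }
    search-sound (suc m) cands k ok (r ∷ R)
      with states , ok′ , valid ← search-sound m _ _ ok R
      = concatMap (step r) states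
      , All.lookup (All.all⁺ (λ r → k (concatMap (step r) states)) (allVectors p n) ok′) (∈-allVectors r)
      , λ s∈ → let s , s∈states , s′∈ = find (∈-concatMap⁻ (step r) s∈) in
               step-valid cands r R s (valid s∈states) s′∈

    covers-sound : ∀ cands → T (covers cands) → (R : Vec Row n) →
                   ∃[ A ] A ∈ˡ cands × AgreeOnlyAt0 (comb A) (comb R)
    covers-sound cands ok R with search-sound n (List.map (tt ,_) cands) (not ∘ null) ok R
    ... | [] , () , _
    ... | s ∷ _ , _ , valid with as , mem , ag , _ ← valid (here refl) with A , A∈ , refl ← ∈-map⁻ (tt ,_) mem = A , A∈ , ag

-- Linear maps at invertible distance from 0, 1 and a given map

module _ {p : ℕ} .{{_ : NonZero p}} where

  Avoidable : ∀ {n} → Lin p n n → Set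
  Avoidable M = Σ[ A ∈ Lin p _ _ ] AgreeOnlyAt0 A zeroˡ × AgreeOnlyAt0 A idˡ × AgreeOnlyAt0 A M

  inlˡ : ∀ {m} n → Lin p m (m ℕ.+ n)
  inlˡ n = pairˡ idˡ zeroˡ

  inrˡ : ∀ m {n} → Lin p n (m ℕ.+ n)
  inrˡ m = pairˡ zeroˡ idˡ

  inl+inr : ∀ {m n} (u : 𝔽[ p ]^ m) (w : 𝔽[ p ]^ n) → ap (inlˡ n) u +ᵛ ap (inrˡ m) w ≡ u ++ w
  inl+inr u w = trans (+ᵛ-++ u 0ᵛ 0ᵛ w) (cong₂ _++_ (𝔽ᵥ.identityʳ u) (𝔽ᵥ.identityˡ w))

  split-≡0 : ∀ m {n} (z : 𝔽[ p ]^ (m ℕ.+ n)) → take m z ≡ 0ᵛ → drop m z ≡ 0ᵛ → z ≡ 0ᵛ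
  split-≡0 m z e e′ = trans (sym (Vec.take++drop≡id m z)) (trans (cong₂ _++_ e e′) (0ᵛ-++ m))

  -- A is block triangular with the off-diagonal block of M, so that A - M is
  -- block triangular the other way round.
  avoidable-block : ∀ m {n} (M : Lin p (m ℕ.+ n) (m ℕ.+ n)) →
    Avoidable (takeˡ m ∘ˡ M ∘ˡ inlˡ n) → Avoidable (dropˡ m ∘ˡ M ∘ˡ inrˡ m) → Avoidable M
  avoidable-block m {n} M (A₁ , A₁≢0 , A₁≢1 , A₁≢M) (A₂ , A₂≢0 , A₂≢1 , A₂≢M) =
    A , (λ z e → let u≡0 = A₁≢0 (take m z) (trans (sym (take-A z)) (trans (cong (take m) e) (ap-0 (takeˡ m {n})))) in
                 split-≡0 m z u≡0 (A₂≢0 (drop m z) (trans (sym (drop-A z u≡0)) (trans (cong (drop m) e) (ap-0 (dropˡ m {n}))))))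
      , (λ z e → let u≡0 = A₁≢1 (take m z) (trans (sym (take-A z)) (cong (take m) e)) in
                 split-≡0 m z u≡0 (A₂≢1 (drop m z) (trans (sym (drop-A z u≡0)) (cong (drop m) e))))
      , (λ z e → let w≡0 = A₂≢M (drop m z) (𝔽ᵥₚ.∙-cancelˡ (ap M₁₂ (take m z)) _ _
                           (trans (sym (drop-++ (ap A₁ (take m z)) _)) (trans (cong (drop m) e) (drop-M z)))) in
                 split-≡0 m z (A₁≢M (take m z) (trans (sym (take-A z)) (trans (cong (take m) e) (take-M z w≡0)))) w≡0)
    where
    M₁₂ : Lin p m n
    M₁₂ = dropˡ m ∘ˡ M ∘ˡ inlˡ n
    A : Lin p (m ℕ.+ n) (m ℕ.+ n)
    A = pairˡ (A₁ ∘ˡ takeˡ m) ((M₁₂ ∘ˡ takeˡ m) +ˡ (A₂ ∘ˡ dropˡ m))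
    take-A : ∀ z → take m (ap A z) ≡ ap A₁ (take m z)
    take-A z = take-++ (ap A₁ (take m z)) _
    drop-A : ∀ z → take m z ≡ 0ᵛ → drop m (ap A z) ≡ ap A₂ (drop m z)
    drop-A z e = trans (drop-++ (ap A₁ (take m z)) _) (trans (cong (_+ᵛ ap A₂ (drop m z)) (trans (cong (ap M₁₂) e) (ap-0 M₁₂))) (𝔽ᵥ.identityˡ _))
    ap-M : ∀ z → ap M z ≡ ap M (ap (inlˡ n) (take m z)) +ᵛ ap M (ap (inrˡ m) (drop m z))
    ap-M z = trans (cong (ap M) (sym (trans (inl+inr (take m z) (drop m z)) (Vec.take++drop≡id m z)))) (ap-+ M _ _)
    drop-M : ∀ z → drop m (ap M z) ≡ ap M₁₂ (take m z) +ᵛ drop m (ap M (ap (inrˡ m) (drop m z)))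
    drop-M z = trans (cong (drop m) (ap-M z)) (ap-+ (dropˡ m {n}) (ap M (ap (inlˡ n) (take m z))) _)
    take-M : ∀ z → drop m z ≡ 0ᵛ → take m (ap M z) ≡ take m (ap M (ap (inlˡ n) (take m z)))
    take-M z e = trans (cong (take m) (ap-M z)) (trans (ap-+ (takeˡ m {n}) (ap M (ap (inlˡ n) (take m z))) _)
      (trans (cong (take m (ap M (ap (inlˡ n) (take m z))) +ᵛ_)
        (trans (cong (ap (takeˡ m ∘ˡ M ∘ˡ inrˡ m)) e) (ap-0 (takeˡ m ∘ˡ M ∘ˡ inrˡ m)))) (𝔽ᵥ.identityʳ _)))

  -- The maps 0 and 1 commute with `P`, so all three conditions survive conjugation, and an
  -- involution serves as its own inverse.
  avoidable-conjugate : ∀ {n} (P : Lin p n n) → (∀ u → ap P (ap P u) ≡ u) → (M : Lin p n n) →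
    Avoidable (P ∘ˡ M ∘ˡ P) → Avoidable M
  avoidable-conjugate P P² M (A , A≢0 , A≢1 , A≢M) =
    P ∘ˡ A ∘ˡ P , (λ u e → back u (A≢0 (ap P u) (trans (sym (P² _)) (trans (cong (ap P) e) (ap-0 P)))))
                , (λ u e → back u (A≢1 (ap P u) (trans (sym (P² _)) (cong (ap P) e))))
                , (λ u e → back u (A≢M (ap P u) (trans (sym (P² _)) (trans (cong (ap P) e) (cong (ap P ∘ ap M) (sym (P² u)))))))
    where
    back : ∀ u → ap P u ≡ 0ᵛ → u ≡ 0ᵛ
    back u e = trans (sym (P² u)) (trans (cong (ap P) e) (ap-0 P))

  avoidable-cong : ∀ {n} {M N : Lin p n n} → (∀ u → ap M u ≡ ap N u) → Avoidable M → Avoidable N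
  avoidable-cong M≗N (A , A≢0 , A≢1 , A≢M) = A , A≢0 , A≢1 , λ u e → A≢M u (trans e (sym (M≗N u)))

  -- Singular `M` are included, because a diagonal block of an invertible matrix need not be
  -- invertible.
  AllAvoidable : ℕ → Set
  AllAvoidable n = ∀ (M : Lin p n n) → Avoidable M

  allAvoidable-+ : ∀ {m n} → AllAvoidable m → AllAvoidable n → AllAvoidable (m ℕ.+ n)
  allAvoidable-+ {m} {n} gm gn M = avoidable-block m M (gm (takeˡ m ∘ˡ M ∘ˡ inlˡ n)) (gn (dropˡ m ∘ˡ M ∘ˡ inrˡ m))

  allAvoidable-0 : AllAvoidable 0
  allAvoidable-0 M = idˡ , (λ { [] _ → refl }) , (λ { [] _ → refl }) , λ { [] _ → refl }

  all-vectors? : ∀ {n} {P : 𝔽[ p ]^ n → Set} → Decidable P → Dec (∀ u → P u)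
  all-vectors? {zero}  P? = map′ (λ { h [] → h }) (λ h → h []) (P? [])
  all-vectors? {suc n} P? = map′ (λ { h (a ∷ u) → h a u }) (λ h a u → h (a ∷ u)) (Fin.all? λ a → all-vectors? λ u → P? (a ∷ u))

  agreeOnlyAt0? : ∀ {m n} (f h : Lin p m n) → Dec (AgreeOnlyAt0 f h)
  agreeOnlyAt0? f h = all-vectors? λ u → (ap f u ≟ᵛ ap h u) →-dec (u ≟ᵛ 0ᵛ)

  EigenvaluesAvoid01 : ∀ {n} → Vec (𝔽[ p ]^ n) n → Set
  EigenvaluesAvoid01 A = AgreeOnlyAt0 (comb A) zeroˡ × AgreeOnlyAt0 (comb A) idˡ

  eigenvaluesAvoid01? : ∀ {n} → Decidable (EigenvaluesAvoid01 {n})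
  eigenvaluesAvoid01? A = agreeOnlyAt0? (comb A) zeroˡ ×-dec agreeOnlyAt0? (comb A) idˡ

  allAvoidable-search : ∀ {n} → Prime p → (As : List (Vec (𝔽[ p ]^ n) n)) → All EigenvaluesAvoid01 As →
                        Search.covers (allVectors p n) (allFin p) As ≡ true → AllAvoidable n
  allAvoidable-search p-prime As As-ok ok M
    with A , A∈ , ag ← SearchSound.covers-sound p-prime As (subst T (sym ok) tt) (rows M)
    with A≢0 , A≢1 ← All.lookup As-ok A∈
    = comb A , A≢0 , A≢1 , λ u e → ag u (trans e (sym (comb-rows M u)))

-- Admissible block sizes for each prime

fromTrue : ∀ {P : Set} (P? : Dec P) → does P? ≡ true → P
fromTrue (yes P) _ = P

allAvoidable-1 : ∀ {q} → let p = 4 ℕ.+ q in Prime p → AllAvoidable {p} 1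
allAvoidable-1 {q} p-prime M = solve
  where
  p = 4 ℕ.+ q
  agree : ∀ (a b : 𝔽 p) → a ≢ b → ∀ c → a *ᶠ c ≡ b *ᶠ c → c ≡ 0ᶠ
  agree a b a≢b c e = *ᶠ-zero-divisor-free p-prime (a +ᶠ (-ᶠ b)) c (λ e′ → a≢b (x∙y⁻¹≈ε⇒x≈y a b e′))
    (trans (𝔽ᵣ.distribʳ c a (-ᶠ b)) (trans (cong₂ _+ᶠ_ e (sym (-‿distribˡ-* b c))) (+ᶠ-inverseʳ (b *ᶠ c))))
    where
    open import Algebra.Properties.Ring (𝔽ᵣ.ring {p}) using (-‿distribˡ-*)
    open import Algebra.Properties.Group (𝔽ᵣ.+-group {p}) using (x∙y⁻¹≈ε⇒x≈y)
  head : ∀ {a b : 𝔽 p} → a ∷ [] ≡ b ∷ [] → a ≡ b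
  head refl = refl
  byScalar : ∀ (a m : 𝔽 p) → a ≢ 0ᶠ → a ≢ 1ᶠ → a ≢ m → ap M (1ᶠ ∷ []) ≡ m ∷ [] → Avoidable M
  byScalar a m a≢0 a≢1 a≢m eq = scaleˡ a
    , (λ { (c ∷ []) e → cong (_∷ []) (agree a 0ᶠ a≢0 c (trans (head e) (sym (𝔽ᵣ.zeroˡ c)))) })
    , (λ { (c ∷ []) e → cong (_∷ []) (agree a 1ᶠ a≢1 c (trans (head e) (sym (*ᶠ-identityˡ c)))) })
    , (λ { (c ∷ []) e → cong (_∷ []) (agree a m a≢m c (head (trans e (ap-M c)))) })
    where
    ap-M : ∀ c → ap M (c ∷ []) ≡ m *ᶠ c ∷ []
    ap-M c = trans (cong (ap M) (cong (_∷ []) (sym (𝔽ᵣ.*-identityʳ c))))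
      (trans (ap-· M c (1ᶠ ∷ [])) (trans (cong (c ·ᵛ_) eq) (cong (_∷ []) (*ᶠ-comm c m))))
  solve : Avoidable M
  -- `M` is multiplication by `m`, so the scalar has to avoid 0, 1 and `m`. The residues 2 and 3 are
  -- available because `p` is at least 4, and `m` excludes at most one of them.
  solve with ap M (1ᶠ ∷ []) in eq
  ... | m ∷ [] with m Fin.≟ 2F
  ...   | yes refl = byScalar 3F 2F (λ ()) (λ ()) (λ ()) eq
  ...   | no m≢2   = byScalar 2F m (λ ()) (λ ()) (m≢2 ∘ sym) eq

allAvoidable-p≥4 : ∀ {q} → let p = 4 ℕ.+ q in Prime p → ∀ n → AllAvoidable {p} n
allAvoidable-p≥4 pr zero    = allAvoidable-0
allAvoidable-p≥4 pr (suc n) = allAvoidable-+ (allAvoidable-1 pr) (allAvoidable-p≥4 pr n)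

3-prime : Prime 3
3-prime = toWitness {a? = prime? 3} tt

2-prime : Prime 2
2-prime = toWitness {a? = prime? 2} tt

-- The lists As-p-n were found by a greedy search.
As-3-2 : List (Vec (𝔽[ 3 ]^ 2) 2)
As-3-2 = 
  ((1F ∷ 2F ∷ []) ∷ (2F ∷ 0F ∷ []) ∷ []) ∷
  ((0F ∷ 2F ∷ []) ∷ (1F ∷ 1F ∷ []) ∷ []) ∷
  ((2F ∷ 2F ∷ []) ∷ (0F ∷ 2F ∷ []) ∷ []) ∷ []

As-3-3 : List (Vec (𝔽[ 3 ]^ 3) 3)
As-3-3 = 
  ((2F ∷ 0F ∷ 1F ∷ []) ∷ (0F ∷ 0F ∷ 1F ∷ []) ∷ (1F ∷ 2F ∷ 2F ∷ []) ∷ []) ∷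
  ((2F ∷ 0F ∷ 2F ∷ []) ∷ (2F ∷ 1F ∷ 2F ∷ []) ∷ (0F ∷ 1F ∷ 2F ∷ []) ∷ []) ∷
  ((2F ∷ 1F ∷ 0F ∷ []) ∷ (2F ∷ 2F ∷ 2F ∷ []) ∷ (2F ∷ 2F ∷ 0F ∷ []) ∷ []) ∷
  ((2F ∷ 2F ∷ 2F ∷ []) ∷ (0F ∷ 2F ∷ 0F ∷ []) ∷ (2F ∷ 0F ∷ 0F ∷ []) ∷ []) ∷
  ((2F ∷ 1F ∷ 2F ∷ []) ∷ (1F ∷ 1F ∷ 2F ∷ []) ∷ (2F ∷ 0F ∷ 1F ∷ []) ∷ []) ∷
  ((2F ∷ 0F ∷ 0F ∷ []) ∷ (1F ∷ 2F ∷ 1F ∷ []) ∷ (0F ∷ 1F ∷ 1F ∷ []) ∷ []) ∷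
  ((0F ∷ 2F ∷ 1F ∷ []) ∷ (2F ∷ 1F ∷ 1F ∷ []) ∷ (0F ∷ 2F ∷ 2F ∷ []) ∷ []) ∷
  ((2F ∷ 1F ∷ 0F ∷ []) ∷ (1F ∷ 2F ∷ 1F ∷ []) ∷ (0F ∷ 1F ∷ 2F ∷ []) ∷ []) ∷
  ((1F ∷ 1F ∷ 2F ∷ []) ∷ (2F ∷ 1F ∷ 0F ∷ []) ∷ (2F ∷ 2F ∷ 0F ∷ []) ∷ []) ∷ []

As-2-3 : List (Vec (𝔽[ 2 ]^ 3) 3)
As-2-3 = 
  ((1F ∷ 1F ∷ 1F ∷ []) ∷ (1F ∷ 1F ∷ 0F ∷ []) ∷ (0F ∷ 1F ∷ 1F ∷ []) ∷ []) ∷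
  ((1F ∷ 0F ∷ 1F ∷ []) ∷ (1F ∷ 1F ∷ 1F ∷ []) ∷ (1F ∷ 1F ∷ 0F ∷ []) ∷ []) ∷
  ((0F ∷ 0F ∷ 1F ∷ []) ∷ (1F ∷ 0F ∷ 1F ∷ []) ∷ (1F ∷ 1F ∷ 1F ∷ []) ∷ []) ∷
  ((1F ∷ 1F ∷ 0F ∷ []) ∷ (0F ∷ 1F ∷ 1F ∷ []) ∷ (1F ∷ 0F ∷ 0F ∷ []) ∷ []) ∷
  ((0F ∷ 1F ∷ 0F ∷ []) ∷ (0F ∷ 0F ∷ 1F ∷ []) ∷ (1F ∷ 0F ∷ 1F ∷ []) ∷ []) ∷
  ((0F ∷ 1F ∷ 1F ∷ []) ∷ (1F ∷ 0F ∷ 0F ∷ []) ∷ (0F ∷ 1F ∷ 0F ∷ []) ∷ []) ∷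
  ((0F ∷ 1F ∷ 0F ∷ []) ∷ (0F ∷ 1F ∷ 1F ∷ []) ∷ (1F ∷ 0F ∷ 0F ∷ []) ∷ []) ∷
  ((1F ∷ 1F ∷ 1F ∷ []) ∷ (1F ∷ 0F ∷ 1F ∷ []) ∷ (0F ∷ 1F ∷ 1F ∷ []) ∷ []) ∷
  ((1F ∷ 1F ∷ 1F ∷ []) ∷ (1F ∷ 1F ∷ 0F ∷ []) ∷ (1F ∷ 0F ∷ 0F ∷ []) ∷ []) ∷
  ((1F ∷ 1F ∷ 0F ∷ []) ∷ (1F ∷ 0F ∷ 1F ∷ []) ∷ (0F ∷ 1F ∷ 0F ∷ []) ∷ []) ∷
  ((0F ∷ 1F ∷ 0F ∷ []) ∷ (0F ∷ 0F ∷ 1F ∷ []) ∷ (1F ∷ 1F ∷ 0F ∷ []) ∷ []) ∷ []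

As-2-4 : List (Vec (𝔽[ 2 ]^ 4) 4)
As-2-4 = 
  ((0F ∷ 0F ∷ 1F ∷ 0F ∷ []) ∷ (1F ∷ 0F ∷ 1F ∷ 0F ∷ []) ∷ (1F ∷ 0F ∷ 1F ∷ 1F ∷ []) ∷ (1F ∷ 1F ∷ 0F ∷ 1F ∷ []) ∷ []) ∷
  ((0F ∷ 1F ∷ 0F ∷ 0F ∷ []) ∷ (1F ∷ 1F ∷ 1F ∷ 1F ∷ []) ∷ (0F ∷ 0F ∷ 1F ∷ 1F ∷ []) ∷ (0F ∷ 0F ∷ 1F ∷ 0F ∷ []) ∷ []) ∷
  ((0F ∷ 0F ∷ 0F ∷ 1F ∷ []) ∷ (0F ∷ 0F ∷ 1F ∷ 1F ∷ []) ∷ (0F ∷ 1F ∷ 0F ∷ 0F ∷ []) ∷ (1F ∷ 1F ∷ 0F ∷ 1F ∷ []) ∷ []) ∷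
  ((1F ∷ 1F ∷ 1F ∷ 0F ∷ []) ∷ (1F ∷ 0F ∷ 0F ∷ 1F ∷ []) ∷ (1F ∷ 0F ∷ 1F ∷ 0F ∷ []) ∷ (0F ∷ 1F ∷ 0F ∷ 1F ∷ []) ∷ []) ∷
  ((1F ∷ 1F ∷ 0F ∷ 1F ∷ []) ∷ (1F ∷ 0F ∷ 1F ∷ 1F ∷ []) ∷ (1F ∷ 1F ∷ 1F ∷ 1F ∷ []) ∷ (0F ∷ 1F ∷ 0F ∷ 1F ∷ []) ∷ []) ∷
  ((1F ∷ 1F ∷ 0F ∷ 0F ∷ []) ∷ (0F ∷ 1F ∷ 0F ∷ 1F ∷ []) ∷ (1F ∷ 1F ∷ 0F ∷ 1F ∷ []) ∷ (0F ∷ 1F ∷ 1F ∷ 1F ∷ []) ∷ []) ∷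
  ((0F ∷ 1F ∷ 0F ∷ 1F ∷ []) ∷ (1F ∷ 1F ∷ 0F ∷ 0F ∷ []) ∷ (1F ∷ 1F ∷ 1F ∷ 0F ∷ []) ∷ (0F ∷ 1F ∷ 1F ∷ 0F ∷ []) ∷ []) ∷
  ((1F ∷ 1F ∷ 0F ∷ 1F ∷ []) ∷ (0F ∷ 1F ∷ 1F ∷ 0F ∷ []) ∷ (0F ∷ 0F ∷ 0F ∷ 1F ∷ []) ∷ (1F ∷ 1F ∷ 1F ∷ 1F ∷ []) ∷ []) ∷
  ((0F ∷ 1F ∷ 1F ∷ 0F ∷ []) ∷ (1F ∷ 0F ∷ 1F ∷ 1F ∷ []) ∷ (1F ∷ 0F ∷ 0F ∷ 0F ∷ []) ∷ (1F ∷ 1F ∷ 0F ∷ 0F ∷ []) ∷ []) ∷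
  ((0F ∷ 0F ∷ 0F ∷ 1F ∷ []) ∷ (0F ∷ 0F ∷ 1F ∷ 0F ∷ []) ∷ (1F ∷ 1F ∷ 0F ∷ 0F ∷ []) ∷ (0F ∷ 1F ∷ 0F ∷ 0F ∷ []) ∷ []) ∷
  ((0F ∷ 1F ∷ 0F ∷ 1F ∷ []) ∷ (0F ∷ 1F ∷ 1F ∷ 1F ∷ []) ∷ (1F ∷ 1F ∷ 1F ∷ 0F ∷ []) ∷ (1F ∷ 0F ∷ 1F ∷ 0F ∷ []) ∷ []) ∷
  ((1F ∷ 0F ∷ 1F ∷ 0F ∷ []) ∷ (0F ∷ 1F ∷ 1F ∷ 1F ∷ []) ∷ (0F ∷ 1F ∷ 0F ∷ 1F ∷ []) ∷ (1F ∷ 1F ∷ 0F ∷ 0F ∷ []) ∷ []) ∷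
  ((0F ∷ 1F ∷ 1F ∷ 1F ∷ []) ∷ (1F ∷ 0F ∷ 0F ∷ 1F ∷ []) ∷ (0F ∷ 1F ∷ 0F ∷ 1F ∷ []) ∷ (1F ∷ 0F ∷ 0F ∷ 0F ∷ []) ∷ []) ∷
  ((0F ∷ 0F ∷ 1F ∷ 0F ∷ []) ∷ (0F ∷ 1F ∷ 1F ∷ 0F ∷ []) ∷ (0F ∷ 0F ∷ 1F ∷ 1F ∷ []) ∷ (1F ∷ 1F ∷ 1F ∷ 0F ∷ []) ∷ []) ∷
  ((0F ∷ 1F ∷ 1F ∷ 0F ∷ []) ∷ (1F ∷ 0F ∷ 0F ∷ 0F ∷ []) ∷ (1F ∷ 1F ∷ 1F ∷ 1F ∷ []) ∷ (1F ∷ 0F ∷ 1F ∷ 1F ∷ []) ∷ []) ∷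
  ((0F ∷ 1F ∷ 1F ∷ 0F ∷ []) ∷ (1F ∷ 1F ∷ 1F ∷ 0F ∷ []) ∷ (0F ∷ 0F ∷ 0F ∷ 1F ∷ []) ∷ (1F ∷ 0F ∷ 1F ∷ 0F ∷ []) ∷ []) ∷
  ((1F ∷ 0F ∷ 0F ∷ 1F ∷ []) ∷ (0F ∷ 0F ∷ 1F ∷ 1F ∷ []) ∷ (0F ∷ 1F ∷ 1F ∷ 1F ∷ []) ∷ (1F ∷ 0F ∷ 1F ∷ 1F ∷ []) ∷ []) ∷
  ((1F ∷ 0F ∷ 1F ∷ 0F ∷ []) ∷ (1F ∷ 1F ∷ 1F ∷ 1F ∷ []) ∷ (1F ∷ 1F ∷ 0F ∷ 0F ∷ []) ∷ (0F ∷ 0F ∷ 1F ∷ 0F ∷ []) ∷ []) ∷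
  ((1F ∷ 1F ∷ 1F ∷ 1F ∷ []) ∷ (0F ∷ 0F ∷ 0F ∷ 1F ∷ []) ∷ (0F ∷ 0F ∷ 1F ∷ 1F ∷ []) ∷ (1F ∷ 0F ∷ 0F ∷ 0F ∷ []) ∷ []) ∷
  ((1F ∷ 1F ∷ 0F ∷ 0F ∷ []) ∷ (0F ∷ 0F ∷ 1F ∷ 1F ∷ []) ∷ (1F ∷ 1F ∷ 1F ∷ 0F ∷ []) ∷ (1F ∷ 0F ∷ 0F ∷ 0F ∷ []) ∷ []) ∷
  ((1F ∷ 1F ∷ 0F ∷ 0F ∷ []) ∷ (0F ∷ 0F ∷ 1F ∷ 0F ∷ []) ∷ (0F ∷ 1F ∷ 1F ∷ 1F ∷ []) ∷ (1F ∷ 1F ∷ 1F ∷ 1F ∷ []) ∷ []) ∷ []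

abstract

  allAvoidable-3-2 : AllAvoidable {3} 2
  allAvoidable-3-2 = allAvoidable-search 3-prime As-3-2 (fromTrue (All.all? eigenvaluesAvoid01? As-3-2) refl) refl

  allAvoidable-3-3 : AllAvoidable {3} 3
  allAvoidable-3-3 = allAvoidable-search 3-prime As-3-3 (fromTrue (All.all? eigenvaluesAvoid01? As-3-3) refl) refl

  allAvoidable-2-3 : AllAvoidable {2} 3
  allAvoidable-2-3 = allAvoidable-search 2-prime As-2-3 (fromTrue (All.all? eigenvaluesAvoid01? As-2-3) refl) refl

  allAvoidable-2-4 : AllAvoidable {2} 4
  allAvoidable-2-4 = allAvoidable-search 2-prime As-2-4 (fromTrue (All.all? eigenvaluesAvoid01? As-2-4) refl) refl

-- Multiplication by the two primitive cube roots of unity of 𝔽₄, in a basis over 𝔽₂. No other 2 × 2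
-- matrix over 𝔽₂ avoids the eigenvalues 0 and 1, since its characteristic polynomial has to be the
-- irreducible quadratic.
ω ω² : Vec (𝔽[ 2 ]^ 2) 2
ω  = (0F ∷ 1F ∷ []) ∷ (1F ∷ 1F ∷ []) ∷ []
ω² = (1F ∷ 1F ∷ []) ∷ (1F ∷ 0F ∷ []) ∷ []

ω-powers : List (Vec (𝔽[ 2 ]^ 2) 2)
ω-powers = ω ∷ ω² ∷ []

-- Conjugation by an involution needs no separate inverse. That these four suffice is what
-- `avoidable-corner` checks.
involutions : List (Vec (𝔽[ 2 ]^ 3) 3)
involutions = 
  ((0F ∷ 0F ∷ 1F ∷ []) ∷ (0F ∷ 1F ∷ 0F ∷ []) ∷ (1F ∷ 0F ∷ 0F ∷ []) ∷ []) ∷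
  ((0F ∷ 0F ∷ 1F ∷ []) ∷ (1F ∷ 1F ∷ 1F ∷ []) ∷ (1F ∷ 0F ∷ 0F ∷ []) ∷ []) ∷
  ((0F ∷ 1F ∷ 0F ∷ []) ∷ (1F ∷ 0F ∷ 0F ∷ []) ∷ (0F ∷ 0F ∷ 1F ∷ []) ∷ []) ∷
  ((0F ∷ 1F ∷ 1F ∷ []) ∷ (0F ∷ 1F ∷ 0F ∷ []) ∷ (1F ∷ 1F ∷ 0F ∷ []) ∷ []) ∷ []

corner : Lin 2 3 3 → Lin 2 2 2
corner N = takeˡ 2 ∘ˡ N ∘ˡ inlˡ 1

abstract

  -- A 2 × 2 matrix over 𝔽₂ differs from ω or ω² by an invertible matrix if it is
  -- scalar or of trace 1, and every 3 × 3 matrix has a conjugate with such a corner.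
  avoidable-corner : ∀ r₀ r₁ r₂ → let N = comb (r₀ ∷ r₁ ∷ r₂ ∷ []) in
    Any (λ P → Any (λ A → AgreeOnlyAt0 (comb A) (corner (comb P ∘ˡ N ∘ˡ comb P))) ω-powers) involutions
  avoidable-corner = fromTrue (all-vectors? λ r₀ → all-vectors? λ r₁ → all-vectors? λ r₂ →
    Any.any? (λ P → Any.any? (λ A → agreeOnlyAt0? (comb A) (corner (comb P ∘ˡ comb (r₀ ∷ r₁ ∷ r₂ ∷ []) ∘ˡ comb P))) ω-powers) involutions) refl

  involutions-involutive : All (λ P → ∀ u → ap (comb P) (ap (comb P) u) ≡ u) involutions
  involutions-involutive = fromTrue (All.all? (λ P → all-vectors? λ u → ap (comb P) (ap (comb P) u) ≟ᵛ u) involutions) refl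

  ω-powers-avoid01 : All EigenvaluesAvoid01 ω-powers
  ω-powers-avoid01 = fromTrue (All.all? eigenvaluesAvoid01? ω-powers) refl

allAvoidable-2-5 : AllAvoidable {2} 5
allAvoidable-2-5 M
  with r₀ ∷ r₁ ∷ r₂ ∷ [] ← rows {2} {m = 3} (takeˡ 3 {2} ∘ˡ M ∘ˡ inlˡ 2) in rows-eq
  with P , P∈ , found ← find (avoidable-corner r₀ r₁ r₂)
  with A , A∈ , ag ← find found
  = avoidable-conjugate P̂ P̂² M (avoidable-block 2 (P̂ ∘ˡ M ∘ˡ P̂) corner-avoidable (allAvoidable-2-3 (dropˡ 2 ∘ˡ (P̂ ∘ˡ M ∘ˡ P̂) ∘ˡ inrˡ 2)))
  where
  N = comb (r₀ ∷ r₁ ∷ r₂ ∷ [])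
  N-eq : ∀ u → ap N u ≡ take 3 (ap M (ap (inlˡ 2) u))
  N-eq u = trans (cong (λ R → ap (comb R) u) (sym rows-eq)) (comb-rows (takeˡ 3 {2} ∘ˡ M ∘ˡ inlˡ 2) u)
  P̂ : Lin 2 5 5
  P̂ = pairˡ (comb P ∘ˡ takeˡ 3) (dropˡ 3 {2})
  P² = All.lookup involutions-involutive P∈
  P̂² : ∀ u → ap P̂ (ap P̂ u) ≡ u
  P̂² u@(_ ∷ _ ∷ _ ∷ _ ∷ _ ∷ []) = cong₂ _++_
    (trans (cong (ap (comb P)) (take-++ (ap (comb P) (take 3 u)) (drop 3 u))) (P² (take 3 u)))
    (drop-++ (ap (comb P) (take 3 u)) (drop 3 u))
  take-2-++ : ∀ (q : 𝔽[ 2 ]^ 3) (w : 𝔽[ 2 ]^ 2) → take 2 (q ++ w) ≡ take 2 q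
  take-2-++ (_ ∷ _ ∷ _ ∷ []) w = refl
  corner-eq : ∀ u → ap (corner (comb P ∘ˡ N ∘ˡ comb P)) u ≡ ap (takeˡ 2 ∘ˡ (P̂ ∘ˡ M ∘ˡ P̂) ∘ˡ inlˡ 3) u
  corner-eq u@(_ ∷ _ ∷ []) = trans (cong (take 2 ∘ ap (comb P)) (N-eq z))
    (sym (take-2-++ (ap (comb P) (take 3 (ap M (ap (inlˡ 2) z)))) (drop 3 (ap M (ap (inlˡ 2) z)))))
    where z = ap (comb P) (ap (inlˡ 1) u)
  corner-avoidable : Avoidable (takeˡ 2 ∘ˡ (P̂ ∘ˡ M ∘ˡ P̂) ∘ˡ inlˡ 3)
  corner-avoidable = let A≢0 , A≢1 = All.lookup ω-powers-avoid01 A∈ in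
    avoidable-cong {M = corner (comb P ∘ˡ N ∘ˡ comb P)} {N = takeˡ 2 ∘ˡ (P̂ ∘ˡ M ∘ˡ P̂) ∘ˡ inlˡ 3} corner-eq (comb A , A≢0 , A≢1 , ag)

allAvoidable-p≡3 : ∀ n → AllAvoidable {3} (2 ℕ.+ n)
allAvoidable-p≡3 0             = allAvoidable-3-2
allAvoidable-p≡3 1             = allAvoidable-3-3
allAvoidable-p≡3 (suc (suc n)) = allAvoidable-+ {m = 2} allAvoidable-3-2 (allAvoidable-p≡3 n)

allAvoidable-p≡2 : ∀ n → AllAvoidable {2} (3 ℕ.+ n)
allAvoidable-p≡2 0                   = allAvoidable-2-3
allAvoidable-p≡2 1                   = allAvoidable-2-4
allAvoidable-p≡2 2                   = allAvoidable-2-5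
allAvoidable-p≡2 (suc (suc (suc n))) = allAvoidable-+ {m = 3} allAvoidable-2-3 (allAvoidable-p≡2 n)

allAvoidable : ∀ d p .{{_ : NonZero d}} .{{_ : NonZero p}} → Prime p →
  ¬ (d ≡ 1 × p ≡ 2) → ¬ (d ≡ 1 × p ≡ 3) → ¬ (d ≡ 2 × p ≡ 2) → AllAvoidable {p} d
allAvoidable d 1 pr _ _ _ = contradiction pr ¬prime[1]
allAvoidable 1 2 _ ¬12 _ _ = contradiction (refl , refl) ¬12
allAvoidable 2 2 _ _ _ ¬22 = contradiction (refl , refl) ¬22
allAvoidable (suc (suc (suc n))) 2 _ _ _ _ = allAvoidable-p≡2 n
allAvoidable 1 3 _ _ ¬13 _ = contradiction (refl , refl) ¬13
allAvoidable (suc (suc n)) 3 _ _ _ _ = allAvoidable-p≡3 n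
allAvoidable d (suc (suc (suc (suc q)))) pr _ _ _ = allAvoidable-p≥4 pr d

private variable
  Ω Ω′ : Set

-- Transversals of equivalence relations

module _ {R : Rel Ω 0ℓ} where

  deduplicate-covers : (R? : Binary.Decidable R) → Reflexive R → Transitive R → ∀ xs {a} → a ∈ˡ xs → ∃[ y ] y ∈ˡ deduplicate R? xs × R y a
  deduplicate-covers R? rf tr (a ∷ xs) (here refl) = a , here refl , rf
  deduplicate-covers R? rf tr (a ∷ xs) {z} (there z∈) with y , y∈ , Ryz ← deduplicate-covers R? rf tr xs z∈ with R? a y
  ... | yes Rxy = a , here refl , tr Rxy Ryz
  ... | no ¬Rxy = y , there (∈-filter⁺ (¬? ∘ R? a) y∈ ¬Rxy) , Ryz

  deduplicate-unrelated : (R? : Binary.Decidable R) → ∀ xs → AllPairs (λ a y → ¬ R a y) (deduplicate R? xs)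
  deduplicate-unrelated R? []       = []
  deduplicate-unrelated R? (a ∷ xs) = All.all-filter (¬? ∘ R? a) (deduplicate R? xs)
    ∷ AllPairs.filter⁺ (¬? ∘ R? a) (deduplicate-unrelated R? xs)

  AllPairs-resp-↭ : Symmetric R → ∀ {xs ys} → xs ↭ ys → AllPairs R xs → AllPairs R ys
  AllPairs-resp-↭ sy _↭_.refl             ps                        = ps
  AllPairs-resp-↭ sy (_↭_.prep a r)       (p ∷ ps)                  = All-resp-↭ r p ∷ AllPairs-resp-↭ sy r ps
  AllPairs-resp-↭ sy (_↭_.swap a y r)     ((pxy ∷ px) ∷ py ∷ ps)    = (sy pxy ∷ All-resp-↭ r py) ∷ All-resp-↭ r px ∷ AllPairs-resp-↭ sy r ps
  AllPairs-resp-↭ sy (_↭_.trans r s)      ps                        = AllPairs-resp-↭ sy s (AllPairs-resp-↭ sy r ps)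

module _ {R : Rel Ω 0ℓ} (sy : Symmetric R) (tr : Transitive R) (h : Ω → Ω′) (h-resp : ∀ {a y} → R a y → h a ≡ h y) where

  -- The head of `xs` has a partner in `ys`, and no other member of either list lies in their class.
  -- Removing the pair leaves two transversals of the remaining classes. The lemma serves both for
  -- equality, to compute the length of a cycle, and for `SameCycle`.
  transversals-↭ : ∀ {xs ys} → AllPairs (λ a y → ¬ R a y) xs → AllPairs (λ a y → ¬ R a y) ys →
    (∀ {a} → a ∈ˡ xs → ∃[ y ] y ∈ˡ ys × R a y) → (∀ {y} → y ∈ˡ ys → ∃[ a ] a ∈ˡ xs × R a y) → map h xs ↭ map h ys
  transversals-↭ {[]} {[]}    _ _ _ _    = ↭-refl
  transversals-↭ {[]} {_ ∷ _} _ _ _ back with _ , () , _ ← back (here refl)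
  transversals-↭ {a ∷ xs} {ys} (x¬ ∷ xs¬) ys¬ forth back
    with y , y∈ , Rxy ← forth (here refl)
    with ys₁ , ys₂ , refl ← ∈-∃++ y∈
    with y¬ ∷ ys′¬ ← AllPairs-resp-↭ (λ ¬R → ¬R ∘ sy) (shift y ys₁ ys₂) ys¬
    = ↭-trans (subst (λ b → h a ∷ map h xs ↭ b ∷ map h (ys₁ List.++ ys₂)) (h-resp Rxy) (prep (h a) (transversals-↭ xs¬ ys′¬ forth′ back′)))
              (↭-sym (map⁺ h (shift y ys₁ ys₂)))
    where
    forth′ : ∀ {x′} → x′ ∈ˡ xs → ∃[ y′ ] y′ ∈ˡ ys₁ List.++ ys₂ × R x′ y′
    forth′ x′∈ with y′ , y′∈ , Rx′y′ ← forth (there x′∈) with ∈-resp-↭ (shift y ys₁ ys₂) y′∈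
    ... | here refl  = contradiction (tr Rxy (sy Rx′y′)) (All.lookup x¬ x′∈)
    ... | there y′∈′ = y′ , y′∈′ , Rx′y′
    back′ : ∀ {y′} → y′ ∈ˡ ys₁ List.++ ys₂ → ∃[ x′ ] x′ ∈ˡ xs × R x′ y′
    back′ y′∈ with back (∈-resp-↭ (↭-sym (shift y ys₁ ys₂)) (there y′∈))
    ... | x′ , here refl , Rxy′ = contradiction (tr (sy Rxy) Rxy′) (All.lookup y¬ y′∈)
    ... | x′ , there x′∈ , R′   = x′ , x′∈ , R′

-- Iteration and periods

iter : (Ω → Ω) → ℕ → Ω → Ω
iter σ zero    ω = ω
iter σ (suc n) ω = iter σ n (σ ω)

iter-+ : ∀ (σ : Ω → Ω) m n ω → iter σ (m ℕ.+ n) ω ≡ iter σ n (iter σ m ω)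
iter-+ σ zero    n ω = refl
iter-+ σ (suc m) n ω = iter-+ σ m n (σ ω)

iter-suc : ∀ (σ : Ω → Ω) n ω → iter σ (suc n) ω ≡ σ (iter σ n ω)
iter-suc σ n ω = trans (cong (λ m → iter σ m ω) (ℕ.+-comm 1 n)) (iter-+ σ n 1 ω)

iter-* : ∀ (σ : Ω → Ω) {k ω} → iter σ k ω ≡ ω → ∀ q → iter σ (q ℕ.* k) ω ≡ ω
iter-* σ e zero    = refl
iter-* σ {k} {ω} e (suc q) = trans (iter-+ σ k (q ℕ.* k) ω) (trans (cong (iter σ (q ℕ.* k)) e) (iter-* σ e q))

iter-injective : ∀ {σ : Ω → Ω} → Injective _≡_ _≡_ σ → ∀ n → Injective _≡_ _≡_ (iter σ n)
iter-injective inj zero    e = e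
iter-injective inj (suc n) e = inj (iter-injective inj n e)

iter-semiconj : ∀ (σ : Ω → Ω) (τ : Ω′ → Ω′) (h : Ω → Ω′) → (∀ ω → h (σ ω) ≡ τ (h ω)) → ∀ n ω → h (iter σ n ω) ≡ iter τ n (h ω)
iter-semiconj σ τ h e zero    ω = refl
iter-semiconj σ τ h e (suc n) ω = trans (iter-semiconj σ τ h e n (σ ω)) (cong (iter τ n) (e ω))

SameCycle : (Ω → Ω) → Ω → Ω → Set
SameCycle σ ω ω′ = ∃[ n ] iter σ n ω ≡ ω′

-- Minimality is stated as divisibility: uniqueness then follows by antisymmetry, and return times
-- of a skew product can be divided by the length of the base cycle.
record IsPeriod (σ : Ω → Ω) (ω : Ω) (ℓ : ℕ) : Set where
  field
    {{nonZero}} : NonZero ℓ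
    returns : iter σ ℓ ω ≡ ω
    minimal : ∀ n → iter σ n ω ≡ ω → ℓ ∣ n

open IsPeriod public

iter-% : ∀ {σ : Ω → Ω} {ω ℓ} .{{_ : NonZero ℓ}} → iter σ ℓ ω ≡ ω → ∀ n → iter σ n ω ≡ iter σ (n % ℓ) ω
iter-% {σ = σ} {ω} {ℓ} e n = begin
  iter σ n ω                              ≡⟨ cong (λ m → iter σ m ω) (trans (m≡m%n+[m/n]*n n ℓ) (ℕ.+-comm (n % ℓ) _)) ⟩
  iter σ (n / ℓ ℕ.* ℓ ℕ.+ n % ℓ) ω        ≡⟨ iter-+ σ (n / ℓ ℕ.* ℓ) (n % ℓ) ω ⟩
  iter σ (n % ℓ) (iter σ (n / ℓ ℕ.* ℓ) ω) ≡⟨ cong (iter σ (n % ℓ)) (iter-* σ e (n / ℓ)) ⟩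
  iter σ (n % ℓ) ω                        ∎
  where open ≡-Reasoning

least : ∀ {P : ℕ → Set} → (∀ n → Dec (P n)) → ∀ n → P n → ∃[ m ] m ≤ n × P m × (∀ k → k < m → ¬ P k)
least P? zero    Pn = 0 , z≤n , Pn , λ _ ()
least P? (suc n) Pn with P? 0
... | yes P0 = 0 , z≤n , P0 , λ _ ()
... | no ¬P0 with m , m≤n , Pm , min ← least (P? ∘ suc) n Pn
  = suc m , s≤s m≤n , Pm , λ { zero _ → ¬P0 ; (suc k) (s≤s k<m) → min k k<m }

module _ {Ω : Set} (_≟_ : DecidableEquality Ω) where

  -- The least positive return time divides every other one, because a nonzero remainder would be a
  -- smaller positive return time. Searching over `suc n` keeps the time 0 out.
  returns⇒period : ∀ (σ : Ω → Ω) ω k → iter σ (suc k) ω ≡ ω → ∃[ ℓ ] ℓ ≤ suc k × IsPeriod σ ω ℓ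
  returns⇒period σ ω k e
    with ℓ , ℓ≤k , e′ , min ← least (λ n → iter σ (suc n) ω ≟ ω) k e
    = suc ℓ , s≤s ℓ≤k , record { returns = e′ ; minimal = minimal′ }
    where
    minimal′ : ∀ n → iter σ n ω ≡ ω → suc ℓ ∣ n
    minimal′ n en with n % suc ℓ in eq
    ... | zero  = m%n≡0⇒n∣m n (suc ℓ) eq
    ... | suc r = contradiction (trans (sym (trans (iter-% e′ n) (cong (λ m → iter σ m ω) eq))) en)
                    (min r (ℕ.s≤s⁻¹ (subst (_< suc ℓ) eq (m%n<n n (suc ℓ)))))

module _ {σ : Ω → Ω} (inj : Injective _≡_ _≡_ σ) where

  iter-cancel : ∀ {m n ω} → m ≤ n → iter σ m ω ≡ iter σ n ω → iter σ (n ∸ m) ω ≡ ω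
  iter-cancel {m} {n} {ω} m≤n e = iter-injective inj m (trans (sym (iter-+ σ (n ∸ m) m ω))
    (trans (cong (λ k → iter σ k ω) (ℕ.m∸n+n≡m m≤n)) (sym e)))

  iter-distinct : ∀ {ω ℓ} → IsPeriod σ ω ℓ → ∀ {i j} → i < j → j < ℓ → iter σ i ω ≢ iter σ j ω
  iter-distinct {ω} {ℓ} per {i} {j} i<j j<ℓ e = ℕ.<⇒≱ (ℕ.≤-<-trans (ℕ.m∸n≤m j i) j<ℓ)
    (∣⇒≤ {{ℕ.>-nonZero (ℕ.m<n⇒0<n∸m i<j)}} (minimal per (j ∸ i) (iter-cancel (ℕ.<⇒≤ i<j) e)))

period-unique : ∀ {σ : Ω → Ω} {ω ℓ ℓ′} → IsPeriod σ ω ℓ → IsPeriod σ ω ℓ′ → ℓ ≡ ℓ′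
period-unique per per′ = ∣-antisym (minimal per _ (returns per′)) (minimal per′ _ (returns per))
  where open import Data.Nat.Divisibility using (∣-antisym)

∈-iterate⁺ : ∀ (σ : Ω → Ω) ω {i n} → i < n → iter σ i ω ∈ˡ iterate σ ω n
∈-iterate⁺ σ ω {zero}  {suc n} _         = here refl
∈-iterate⁺ σ ω {suc i} {suc n} (s≤s i<n) = there (∈-iterate⁺ σ (σ ω) i<n)

∈-iterate⁻ : ∀ (σ : Ω → Ω) ω n {ω′} → ω′ ∈ˡ iterate σ ω n → ∃[ i ] i < n × iter σ i ω ≡ ω′
∈-iterate⁻ σ ω (suc n) (here refl) = 0 , s≤s z≤n , refl
∈-iterate⁻ σ ω (suc n) (there ω′∈) with i , i<n , e ← ∈-iterate⁻ σ (σ ω) n ω′∈ = suc i , s≤s i<n , e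

iterate-distinct : ∀ (σ : Ω → Ω) ω n → (∀ {i j} → i < j → j < n → iter σ i ω ≢ iter σ j ω) → AllPairs _≢_ (iterate σ ω n)
iterate-distinct σ ω zero    ne = []
iterate-distinct σ ω (suc n) ne =
  All.tabulate (λ ω′∈ e → let i , i<n , e′ = ∈-iterate⁻ σ (σ ω) n ω′∈ in ne {0} {suc i} (s≤s z≤n) (s≤s i<n) (trans e (sym e′)))
  ∷ iterate-distinct σ (σ ω) n (λ i<j j<n → ne (s≤s i<j) (s≤s j<n))

-- Monomials

module ℚ[X] = CommutativeSemiring ℚ[x]-commutativeSemiring
open MonoidSum ℚ[X].*-commutativeMonoid using () renaming (sum-cong-≋ to ∏-cong; ∑-distrib-+ to ∏-distrib-*; sum-replicate-zero to ∏-one)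

-- X 0 is a junk value: cycle lengths are positive.
X : ℕ → ℚ[x]
X zero    = con 1ℚ
X (suc n) = x (suc n)

monomial : List ℕ → ℚ[x]
monomial = List.foldr (λ n a → X n * a) (con 1ℚ)

monomial-++ : ∀ L L′ → monomial (L List.++ L′) ≈ monomial L * monomial L′
monomial-++ []      L′ = ≈-sym (*-identityˡ _)
monomial-++ (n ∷ L) L′ = ≈-trans (*-cong ≈-refl (monomial-++ L L′)) (≈-sym (*-assoc _ _ _))

monomial-↭ : ∀ {L L′} → L ↭ L′ → monomial L ≈ monomial L′
monomial-↭ _↭_.refl         = ≈-refl
monomial-↭ (_↭_.prep n r)   = *-cong ≈-refl (monomial-↭ r)
monomial-↭ (_↭_.swap m n r) = ≈-trans (≈-sym (*-assoc _ _ _)) (≈-trans (*-cong (*-comm _ _) (monomial-↭ r)) (*-assoc _ _ _))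
monomial-↭ (_↭_.trans r s)  = ≈-trans (monomial-↭ r) (monomial-↭ s)

BU-monomial : ∀ k L → BU (suc k) (monomial L) ≈ monomial (map (suc k ℕ.*_) L)
BU-monomial k []          = ≈-refl
BU-monomial k (zero ∷ L)  rewrite ℕ.*-zeroʳ k = *-cong ≈-refl (BU-monomial k L)
BU-monomial k (suc n ∷ L) = *-cong ≈-refl (BU-monomial k L)

∏-monomial : ∀ {n} {a : Fin n → ℚ[x]} (L : Fin n → List ℕ) → (∀ i → a i ≈ monomial (L i)) → ∏ a ≈ monomial (concat (List.tabulate L))
∏-monomial {zero}  L e = ≈-refl
∏-monomial {suc n} L e = ≈-trans (*-cong (e Fin.zero) (∏-monomial (L ∘ Fin.suc) (e ∘ Fin.suc))) (≈-sym (monomial-++ (L Fin.zero) _))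

∏-single : ∀ {n} (i : Fin n) {a : Fin n → ℚ[x]} → (∀ j → j ≢ i → a j ≈ con 1ℚ) → ∏ a ≈ a i
∏-single {suc n} Fin.zero e = ≈-trans (*-cong ≈-refl (≈-trans (∏-cong (λ j → e (Fin.suc j) λ ())) (∏-one n))) (≈-trans (*-comm _ _) (*-identityˡ _))
∏-single (Fin.suc i) e = ≈-trans (*-cong (e Fin.zero λ ()) (∏-single i λ j j≢i → e (Fin.suc j) (j≢i ∘ Fin.suc-injective))) (*-identityˡ _)

module _ {A : Set} (h : A → ℕ) where

  count : List A → ℕ → ℕ
  count as m = length (filter (λ a → h a ℕ.≟ m) as)

  -- Prepending `a` raises only the exponent at `h a`, by one. The factor so gained is `δ`, which is
  -- 1 at all other indices. The index witnesses guarantee that no value falls outside the range of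
  -- the product.
  ∏-count : ∀ {n} (as : List A) → All (λ a → Σ[ i ∈ Fin n ] h a ≡ ⟦ i ⟧) as →
            ∏ {n} (λ j → x ⟦ j ⟧ ^ count as ⟦ j ⟧) ≈ monomial (map h as)
  ∏-count {n} []       []             = ∏-one n
  ∏-count {n} (a ∷ as) ((i , e) ∷ es) =
    ≈-trans (∏-cong split) (≈-trans (∏-distrib-* δ _) (*-cong (≈-trans (∏-single i δ-≢) δ-≡) (∏-count as es)))
    where
    δ : Fin n → ℚ[x]
    δ j = if does (h a ℕ.≟ ⟦ j ⟧) then x ⟦ j ⟧ else con 1ℚ
    δ-yes : ∀ {j} → h a ≡ ⟦ j ⟧ → δ j ≡ x ⟦ j ⟧
    δ-yes {j} e = cong (if_then x ⟦ j ⟧ else con 1ℚ) (dec-true (h a ℕ.≟ ⟦ j ⟧) e)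
    δ-no : ∀ {j} → h a ≢ ⟦ j ⟧ → δ j ≡ con 1ℚ
    δ-no {j} ne = cong (if_then x ⟦ j ⟧ else con 1ℚ) (dec-false (h a ℕ.≟ ⟦ j ⟧) ne)
    split : ∀ j → x ⟦ j ⟧ ^ count (a ∷ as) ⟦ j ⟧ ≈ δ j * x ⟦ j ⟧ ^ count as ⟦ j ⟧
    split j = by-cases (h a ℕ.≟ ⟦ j ⟧)
      where
      P? = λ a → h a ℕ.≟ ⟦ j ⟧
      rest = x ⟦ j ⟧ ^ count as ⟦ j ⟧
      by-cases : Dec (h a ≡ ⟦ j ⟧) → x ⟦ j ⟧ ^ count (a ∷ as) ⟦ j ⟧ ≈ δ j * rest
      by-cases (yes e) = ℚ[X].reflexive (trans (cong (λ as → x ⟦ j ⟧ ^ length as) (List.filter-accept P? e))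
        (cong (_* rest) (sym (δ-yes e))))
      by-cases (no ne) = ≈-trans (ℚ[X].reflexive (cong (λ as → x ⟦ j ⟧ ^ length as) (List.filter-reject P? ne)))
        (≈-trans (≈-sym (*-identityˡ rest)) (ℚ[X].reflexive (cong (_* rest) (sym (δ-no ne)))))
    δ-≢ : ∀ j → j ≢ i → δ j ≈ con 1ℚ
    δ-≢ j j≢i = ℚ[X].reflexive (δ-no λ e′ → j≢i (Fin.toℕ-injective (ℕ.suc-injective (trans (sym e′) e))))
    δ-≡ : δ i ≈ X (h a)
    δ-≡ = ℚ[X].reflexive (trans (δ-yes e) (cong X (sym e)))

-- The relation `_≈_` is generated by axioms, so a model is needed to tell expressions apart.
-- Evaluation in ℚ provides one and allows exponents to be read off a monomial.
eval : (ℕ → ℚ) → ℚ[x] → ℚ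
eval v (con q) = q
eval v (x n)   = v n
eval v (a + b) = eval v a ℚ.+ eval v b
eval v (a * b) = eval v a ℚ.* eval v b

eval-cong : ∀ v {a b} → a ≈ b → eval v a ≡ eval v b
eval-cong v ≈-refl             = refl
eval-cong v (≈-sym e)          = sym (eval-cong v e)
eval-cong v (≈-trans e f)      = trans (eval-cong v e) (eval-cong v f)
eval-cong v (+-cong e f)       = cong₂ ℚ._+_ (eval-cong v e) (eval-cong v f)
eval-cong v (*-cong e f)       = cong₂ ℚ._*_ (eval-cong v e) (eval-cong v f)
eval-cong v (+-assoc a b c)    = ℚ.+-assoc (eval v a) (eval v b) (eval v c)
eval-cong v (+-comm a b)       = ℚ.+-comm (eval v a) (eval v b)
eval-cong v (+-identityˡ a)    = ℚ.+-identityˡ (eval v a)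
eval-cong v (*-assoc a b c)    = ℚ.*-assoc (eval v a) (eval v b) (eval v c)
eval-cong v (*-comm a b)       = ℚ.*-comm (eval v a) (eval v b)
eval-cong v (*-identityˡ a)    = ℚ.*-identityˡ (eval v a)
eval-cong v (*-distribʳ a b c) = ℚ.*-distribʳ-+ (eval v a) (eval v b) (eval v c)
eval-cong v (*-zeroˡ a)        = ℚ.*-zeroˡ (eval v a)
eval-cong v (con-+ q r)        = refl
eval-cong v (con-* q r)        = refl

2ℚ : ℚ
2ℚ = 1ℚ ℚ.+ 1ℚ

2^ : ℕ → ℚ
2^ zero    = 1ℚ
2^ (suc n) = 2ℚ ℚ.* 2^ n

2^-positive : ∀ n → Positive (2^ n)
2^-positive zero    = _
2^-positive (suc n) = ℚ.pos*pos⇒pos 2ℚ (2^ n) {{2^-positive n}}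

2^-< : ∀ {m n} → m ℕ.< n → 2^ m ℚ.< 2^ n
2^-< {zero}  {suc zero}    z<s       = ℚ.*<* (+<+ (s<s z<s))
2^-< {zero}  {suc (suc n)} z<s       = ℚ.<-trans (2^-< {0} {suc n} z<s) (subst (ℚ._< 2^ (suc (suc n))) (ℚ.*-identityˡ (2^ (suc n)))
  (ℚ.*-monoˡ-<-pos (2^ (suc n)) {{2^-positive (suc n)}} (2^-< {0} {1} z<s)))
2^-< {suc m} {suc n}       (s<s m<n) = ℚ.*-monoʳ-<-pos 2ℚ (2^-< m<n)

2^-injective : ∀ {m n} → 2^ m ≡ 2^ n → m ≡ n
2^-injective {m} {n} e with ℕ.<-cmp m n
... | tri< m<n _ _ = contradiction (2^-< m<n) (ℚ.<-irrefl e)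
... | tri≈ _ m≡n _ = m≡n
... | tri> _ _ n<m = contradiction (2^-< n<m) (ℚ.<-irrefl (sym e))

-- Evaluate at xᵢ = 2 and xⱼ = 1 for j ≠ i.
∏-exponents : ∀ {n} {k l : Fin n → ℕ} → ∏ (λ j → x ⟦ j ⟧ ^ k j) ≈ ∏ (λ j → x ⟦ j ⟧ ^ l j) → ∀ i → k i ≡ l i
∏-exponents {n} {k} {l} e i = 2^-injective (trans (sym (read k)) (trans (eval-cong v e) (read l)))
  where
  v : ℕ → ℚ
  v m = if does (m ℕ.≟ ⟦ i ⟧) then 2ℚ else 1ℚ
  vi : v ⟦ i ⟧ ≡ 2ℚ
  vi = cong (if_then 2ℚ else 1ℚ) (dec-true (⟦ i ⟧ ℕ.≟ ⟦ i ⟧) refl)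
  vj : ∀ j → j ≢ i → v ⟦ j ⟧ ≡ 1ℚ
  vj j j≢i = cong (if_then 2ℚ else 1ℚ) (dec-false (⟦ j ⟧ ℕ.≟ ⟦ i ⟧) (j≢i ∘ Fin.toℕ-injective ∘ ℕ.suc-injective))
  eval-2 : ∀ {a} m → eval v a ≡ 2ℚ → eval v (a ^ m) ≡ 2^ m
  eval-2 zero    _ = refl
  eval-2 (suc m) e = cong₂ ℚ._*_ e (eval-2 m e)
  eval-1 : ∀ {a} m → eval v a ≡ 1ℚ → eval v (a ^ m) ≡ 1ℚ
  eval-1 zero    _ = refl
  eval-1 (suc m) e = cong₂ ℚ._*_ e (eval-1 m e)
  ∏-1 : ∀ {n} (a : Fin n → ℚ[x]) → (∀ j → eval v (a j) ≡ 1ℚ) → eval v (∏ a) ≡ 1ℚ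
  ∏-1 {zero}  a e = refl
  ∏-1 {suc n} a e = cong₂ ℚ._*_ (e Fin.zero) (∏-1 (a ∘ Fin.suc) (e ∘ Fin.suc))
  ∏-eval : ∀ {n} (i : Fin n) (a : Fin n → ℚ[x]) → (∀ j → j ≢ i → eval v (a j) ≡ 1ℚ) → eval v (∏ a) ≡ eval v (a i)
  ∏-eval Fin.zero    a e = trans (cong (eval v (a Fin.zero) ℚ.*_) (∏-1 (a ∘ Fin.suc) λ j → e (Fin.suc j) λ ())) (ℚ.*-identityʳ _)
  ∏-eval (Fin.suc i) a e = trans (cong₂ ℚ._*_ (e Fin.zero λ ()) (∏-eval i (a ∘ Fin.suc) λ j j≢i → e (Fin.suc j) (j≢i ∘ Fin.suc-injective)))
    (ℚ.*-identityˡ _)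
  read : ∀ m → eval v (∏ (λ j → x ⟦ j ⟧ ^ m j)) ≡ 2^ (m i)
  read m = trans (∏-eval i (λ j → x ⟦ j ⟧ ^ m j) λ j j≢i → eval-1 (m j) (vj j j≢i)) (eval-2 (m i) vi)

-- Cycle types computed from representatives of the cycles

Transversal : {Ω : Set} → (Ω → Ω) → List Ω → Set
Transversal σ T = AllPairs (λ ω ω′ → ¬ SameCycle σ ω ω′) T × (∀ ω → ∃[ τ ] τ ∈ˡ T × SameCycle σ τ ω)

⟦⟧-surjective : ∀ {n N} {{_ : NonZero n}} → n ≤ N → Σ[ j ∈ Fin N ] n ≡ ⟦ j ⟧
⟦⟧-surjective {suc n} n<N = fromℕ< n<N , cong suc (sym (Fin.toℕ-fromℕ< n<N))

module CyclesOf {Ω : Set} (_≟_ : DecidableEquality Ω) (elems : List Ω) (∈-elems : ∀ ω → ω ∈ˡ elems)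
                (σ : Ω → Ω) (σ-injective : Injective _≡_ _≡_ σ) where

  open Cycles _≟_ elems
  open DecMembership _≟_ using (_∈?_)

  per : Ω → ℕ
  per ω = length (cycle σ ω)

  -- Among the iterates 0 to `length elems` two have the same position in `elems`, and injectivity
  -- cancels the earlier one. The bound is what makes the number of iterates listed by `cycle`
  -- sufficient.
  period-exists : ∀ ω → ∃[ ℓ ] ℓ ≤ length elems × IsPeriod σ ω ℓ
  period-exists ω
    with i , j , i<j , e ← Fin.pigeonhole (ℕ.n<1+n (length elems)) (λ i → Any.index (∈-elems (iter σ (toℕ i) ω)))
    with toℕ j ∸ toℕ i | ℕ.m<n⇒0<n∸m i<j | ℕ.≤-trans (ℕ.m∸n≤m (toℕ j) (toℕ i)) (ℕ.s≤s⁻¹ (Fin.toℕ<n j))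
       | iter-cancel σ-injective (ℕ.<⇒≤ i<j) (trans (Any.lookup-index (∈-elems (iter σ (toℕ i) ω)))
           (trans (cong (List.lookup elems) e) (sym (Any.lookup-index (∈-elems (iter σ (toℕ j) ω))))))
  ... | suc k | _ | k<N | e′ with ℓ , ℓ≤k , ℓ-per ← returns⇒period _≟_ σ ω k e′ = ℓ , ℕ.≤-trans ℓ≤k k<N , ℓ-per

  ∈-cycle⁻ : ∀ {ω ω′} → ω′ ∈ˡ cycle σ ω → SameCycle σ ω ω′
  ∈-cycle⁻ {ω} ω′∈ with i , _ , e ← ∈-iterate⁻ σ ω (length elems) (∈-deduplicate⁻ _≟_ _ ω′∈) = i , e

  ∈-cycle⁺ : ∀ {ω ω′} → SameCycle σ ω ω′ → ω′ ∈ˡ cycle σ ω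
  ∈-cycle⁺ {ω} (n , refl) with ℓ , ℓ≤N , ℓ-per ← period-exists ω =
    ∈-deduplicate⁺ _≟_ (subst (_∈ˡ iterate σ ω (length elems)) (sym (iter-% {{nonZero ℓ-per}} (returns ℓ-per) n))
      (∈-iterate⁺ σ ω (ℕ.<-≤-trans (m%n<n n ℓ {{nonZero ℓ-per}}) ℓ≤N)))

  SameCycle-trans : Transitive (SameCycle σ)
  SameCycle-trans {ω} (m , refl) (n , refl) = m ℕ.+ n , iter-+ σ m n ω

  -- After `n % ℓ` steps, another `ℓ ∸ n % ℓ` steps complete the period.
  SameCycle-sym : Symmetric (SameCycle σ)
  SameCycle-sym {ω} (n , refl) with ℓ , _ , ℓ-per ← period-exists ω = ℓ ∸ n % ℓ , (begin
    iter σ (ℓ ∸ n % ℓ) (iter σ n ω)       ≡⟨ cong (iter σ (ℓ ∸ n % ℓ)) (iter-% (returns ℓ-per) n) ⟩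
    iter σ (ℓ ∸ n % ℓ) (iter σ (n % ℓ) ω) ≡⟨ sym (iter-+ σ (n % ℓ) (ℓ ∸ n % ℓ) ω) ⟩
    iter σ (n % ℓ ℕ.+ (ℓ ∸ n % ℓ)) ω      ≡⟨ cong (λ m → iter σ m ω) (ℕ.m+[n∸m]≡n (ℕ.<⇒≤ (m%n<n n ℓ))) ⟩
    iter σ ℓ ω                            ≡⟨ returns ℓ-per ⟩
    ω                                     ∎)
    where
    open ≡-Reasoning
    instance _ = nonZero ℓ-per

  per-isPeriod : ∀ ω → IsPeriod σ ω (per ω)
  per-isPeriod ω with ℓ , ℓ≤N , ℓ-per ← period-exists ω = subst (IsPeriod σ ω) (sym length-cycle) ℓ-per
    where
    instance _ = nonZero ℓ-per
    -- The deduplicated iterates and the first `ℓ` iterates are both repetition-free lists of the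
    -- same points, that is, transversals for equality.
    length-cycle : per ω ≡ ℓ
    length-cycle = trans (↭-length (↭-trans (↭-reflexive (sym (List.map-id _))) (↭-trans
      (transversals-↭ sym trans id id (deduplicate-unrelated _≟_ _) (iterate-distinct σ ω ℓ (iter-distinct σ-injective ℓ-per))
        (λ ω′∈ → let i , e = ∈-cycle⁻ ω′∈ in
           _ , subst (_∈ˡ iterate σ ω ℓ) (trans (sym (iter-% (returns ℓ-per) i)) e) (∈-iterate⁺ σ ω (m%n<n i ℓ)) , refl)
        (λ ω′∈ → let i , _ , e = ∈-iterate⁻ σ ω ℓ ω′∈ in _ , ∈-cycle⁺ (i , e) , refl))
      (↭-reflexive (List.map-id _))))) (List.length-iterate σ ω ℓ)

  per≤ : ∀ ω → per ω ≤ length elems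
  per≤ ω with ℓ , ℓ≤N , ℓ-per ← period-exists ω = subst (_≤ length elems) (period-unique ℓ-per (per-isPeriod ω)) ℓ≤N

  per-index : ∀ ω → Σ[ j ∈ Fin (length elems) ] per ω ≡ ⟦ j ⟧
  per-index ω = ⟦⟧-surjective {{nonZero (per-isPeriod ω)}} (per≤ ω)

  isPeriod-iter : ∀ {ω ℓ} n → IsPeriod σ ω ℓ → IsPeriod σ (iter σ n ω) ℓ
  isPeriod-iter {ω} {ℓ} n ℓ-per = record
    { nonZero = nonZero ℓ-per
    ; returns = trans (swap ℓ) (cong (iter σ n) (returns ℓ-per))
    ; minimal = λ m e → minimal ℓ-per m (iter-injective σ-injective n (trans (sym (swap m)) e)) }
    where
    swap : ∀ m → iter σ m (iter σ n ω) ≡ iter σ n (iter σ m ω)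
    swap m = trans (sym (iter-+ σ n m ω)) (trans (cong (λ k → iter σ k ω) (ℕ.+-comm n m)) (iter-+ σ m n ω))

  per-cong : ∀ {ω ω′} → SameCycle σ ω ω′ → per ω ≡ per ω′
  per-cong {ω} (n , refl) = period-unique (isPeriod-iter n (per-isPeriod ω)) (per-isPeriod (iter σ n ω))

  representatives : List Ω
  representatives = deduplicate (λ ω ω′ → ω′ ∈? cycle σ ω) elems

  representatives-transversal : Transversal σ representatives
  representatives-transversal =
      AllPairs.map (λ ¬∈ → ¬∈ ∘ ∈-cycle⁺) (deduplicate-unrelated _ elems)
    , λ ω → let τ , τ∈ , ω∈ = deduplicate-covers (λ ω ω′ → ω′ ∈? cycle σ ω) (∈-cycle⁺ (0 , refl))
                  (λ p q → ∈-cycle⁺ (SameCycle-trans (∈-cycle⁻ p) (∈-cycle⁻ q))) elems (∈-elems ω)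
            in τ , τ∈ , ∈-cycle⁻ ω∈

  cycleType-representatives : cycleType σ ≈ monomial (map per representatives)
  cycleType-representatives = subst (cycleType σ ≈_) (cong monomial (sym (List.map-∘ representatives)))
    (∏-count length (cycles σ) (All.map⁺ (All.universal per-index representatives)))

  -- Periods are constant on cycles, so any choice of representatives gives the same monomial. The
  -- cycle type of the constructed map can thus be read off representatives adapted to its fibres.
  cycleType-transversal : ∀ T → Transversal σ T → cycleType σ ≈ monomial (map per T)
  cycleType-transversal T (T-unrelated , T-covers) = ≈-trans cycleType-representatives (monomial-↭
    (transversals-↭ SameCycle-sym SameCycle-trans per per-cong (proj₁ representatives-transversal) T-unrelated
      (λ {ω} _ → let τ , τ∈ , s = T-covers ω in τ , τ∈ , SameCycle-sym s)
      (λ {τ} _ → proj₂ representatives-transversal τ)))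

-- Complete affine maps and their products

module _ {p : ℕ} .{{_ : NonZero p}} where

  NoEigenvalue-1 : ∀ {d} → Lin p d d → Set
  NoEigenvalue-1 f = ∀ u → ap f u +ᵛ u ≡ 0ᵛ → u ≡ 0ᵛ

  invˡ : ∀ {m n} (f : Lin p m n) → TrivialKernel f → (∀ v → ∃[ u ] ap f u ≡ v) → Σ[ h ∈ Lin p n m ] ∀ v → ap f (ap h v) ≡ v
  invˡ f tk onto = record { ap = inv ; ap-+ = inv-+ ; ap-· = inv-· } , f-inv
    where
    inj = trivialKernel⇒injective f tk
    inv = λ v → proj₁ (onto v)
    f-inv : ∀ v → ap f (inv v) ≡ v
    f-inv v = proj₂ (onto v)
    inv-+ : ∀ u v → inv (u +ᵛ v) ≡ inv u +ᵛ inv v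
    inv-+ u v = inj (trans (f-inv (u +ᵛ v)) (sym (trans (ap-+ f (inv u) (inv v)) (cong₂ _+ᵛ_ (f-inv u) (f-inv v)))))
    inv-· : ∀ c v → inv (c ·ᵛ v) ≡ c ·ᵛ inv v
    inv-· c v = inj (trans (f-inv (c ·ᵛ v)) (sym (trans (ap-· f c (inv v)) (cong (c ·ᵛ_) (f-inv v)))))

record CompleteAffine (p : ℕ) .{{_ : NonZero p}} (d : ℕ) : Set where
  field
    linear : Lin p d d
    offset : 𝔽[ p ]^ d
    linear-trivialKernel : TrivialKernel linear
    linear-noEigenvalue-1 : NoEigenvalue-1 linear

  act : 𝔽[ p ]^ d → 𝔽[ p ]^ d
  act u = ap linear u +ᵛ offset

  act-injective : Injective _≡_ _≡_ act
  act-injective {u} {v} e = trivialKernel⇒injective linear linear-trivialKernel (𝔽ᵥₚ.∙-cancelʳ offset (ap linear u) (ap linear v) e)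

  act+id-injective : Injective _≡_ _≡_ (λ u → act u +ᵛ u)
  act+id-injective {u} {v} e = trivialKernel⇒injective (linear +ˡ idˡ) linear-noEigenvalue-1
    (𝔽ᵥₚ.∙-cancelʳ offset _ _ (trans (sym (swap u)) (trans e (swap v))))
    where
    swap : ∀ u → act u +ᵛ u ≡ (ap linear u +ᵛ u) +ᵛ offset
    swap u = trans (𝔽ᵥ.assoc (ap linear u) offset u) (trans (cong (ap linear u +ᵛ_) (𝔽ᵥ.comm offset u)) (sym (𝔽ᵥ.assoc (ap linear u) u offset)))

open CompleteAffine public

module _ {p : ℕ} .{{_ : NonZero p}} {d : ℕ} where

  run : (ℕ → CompleteAffine p d) → ℕ → 𝔽[ p ]^ d → 𝔽[ p ]^ d
  run α zero    u = u
  run α (suc n) u = act (α n) (run α n u)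

  infixr 5 _◂_

  _◂_ : CompleteAffine p d → (ℕ → CompleteAffine p d) → ℕ → CompleteAffine p d
  (a ◂ α) zero    = a
  (a ◂ α) (suc n) = α n

  run-◂ : ∀ a α n u → run (a ◂ α) (suc n) u ≡ run α n (act a u)
  run-◂ a α zero    u = refl
  run-◂ a α (suc n) u = cong (act (α n)) (run-◂ a α n u)

  run-injective : ∀ α n → Injective _≡_ _≡_ (run α n)
  run-injective α zero    e = e
  run-injective α (suc n) e = run-injective α n (act-injective (α n) e)

  IsProduct : ℕ → (𝔽[ p ]^ d → 𝔽[ p ]^ d) → Set
  IsProduct ℓ σ = Σ[ α ∈ (ℕ → CompleteAffine p d) ] (∀ u → run α ℓ u ≡ σ u)

  -- The second factor satisfies `S` again, so it can be split further and longer products arise by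
  -- induction. The class `S` is a parameter because the exceptional pairs allow only particular
  -- linear parts.
  Factorable : (Lin p d d → Set) → Set
  Factorable S = ∀ M → S M → Σ[ A ∈ Lin p d d ] Σ[ B ∈ Lin p d d ]
    TrivialKernel A × NoEigenvalue-1 A × TrivialKernel B × NoEigenvalue-1 B × S B × (∀ u → ap B (ap A u) ≡ ap M u)

  completeAffine : (A : Lin p d d) → TrivialKernel A → NoEigenvalue-1 A → 𝔽[ p ]^ d → CompleteAffine p d
  completeAffine A A-tk A-ne v = record { linear = A ; offset = v ; linear-trivialKernel = A-tk ; linear-noEigenvalue-1 = A-ne }

  -- The last factor carries the whole translation `v`. All earlier factors are linear, so splitting
  -- `B` further does not disturb it.
  factorable⇒isProduct : ∀ {S} → Factorable S → ∀ M → S M → ∀ v n → IsProduct (2 ℕ.+ n) (λ u → ap M u +ᵛ v)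
  factorable⇒isProduct fac M SM v zero
    with A , B , A-tk , A-ne , B-tk , B-ne , SB , eq ← fac M SM
    = completeAffine A A-tk A-ne 0ᵛ ◂ (λ _ → completeAffine B B-tk B-ne v)
    , λ u → cong (_+ᵛ v) (trans (cong (ap B) (𝔽ᵥ.identityʳ (ap A u))) (eq u))
  factorable⇒isProduct fac M SM v (suc n)
    with A , B , A-tk , A-ne , B-tk , B-ne , SB , eq ← fac M SM
    with α , run-α ← factorable⇒isProduct fac B SB v n
    = completeAffine A A-tk A-ne 0ᵛ ◂ α
    , λ u → trans (run-◂ (completeAffine A A-tk A-ne 0ᵛ) α (2 ℕ.+ n) u) (trans (run-α (ap A u +ᵛ 0ᵛ))
        (cong (_+ᵛ v) (trans (cong (ap B) (𝔽ᵥ.identityʳ (ap A u))) (eq u))))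

  -- If A, A - 1 and A - M are invertible then M = B (- A) with B = - M A⁻¹, and
  -- -1 is an eigenvalue neither of - A nor of B.
  allAvoidable⇒factorable : AllAvoidable {p} d → Factorable TrivialKernel
  allAvoidable⇒factorable avoid M M-tk with A , A≢0 , A≢1 , A≢M ← avoid M
    = -A , M ∘ˡ -A⁻¹ , -A-tk , -A-ne , B-tk , B-ne , B-tk
    , λ u → cong (ap M) (trivialKernel⇒injective -A -A-tk (-A-A⁻¹ (ap -A u)))
    where
    -A : Lin p d d
    -A = scaleˡ (-ᶠ 1ᶠ) ∘ˡ A
    ap--A : ∀ u → ap -A u ≡ -ᵛ (ap A u)
    ap--A u = -1·ᵛ (ap A u)
    -A-tk : TrivialKernel -A
    -A-tk u e = A≢0 u (trans (sym (𝔽ᵥₚ.⁻¹-involutive (ap A u))) (trans (cong -ᵛ_ (trans (sym (ap--A u)) e)) 𝔽ᵥₚ.ε⁻¹≈ε))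
    -A-ne : NoEigenvalue-1 -A
    -A-ne u e = A≢1 u (trans (sym (𝔽ᵥₚ.⁻¹-involutive (ap A u))) (sym (𝔽ᵥₚ.inverseʳ-unique (-ᵛ (ap A u)) u (trans (cong (_+ᵛ u) (sym (ap--A u))) e))))
    inverse = invˡ -A -A-tk (injective⇒onto (ap -A) (trivialKernel⇒injective -A -A-tk))
    -A⁻¹ = proj₁ inverse
    -A-A⁻¹ = proj₂ inverse
    A⁻¹-0 : ∀ v → ap -A⁻¹ v ≡ 0ᵛ → v ≡ 0ᵛ
    A⁻¹-0 v e = trans (sym (-A-A⁻¹ v)) (trans (cong (ap -A) e) (ap-0 -A))
    B-tk : TrivialKernel (M ∘ˡ -A⁻¹)
    B-tk v e = A⁻¹-0 v (M-tk (ap -A⁻¹ v) e)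
    B-ne : NoEigenvalue-1 (M ∘ˡ -A⁻¹)
    B-ne v e = A⁻¹-0 v (A≢M (ap -A⁻¹ v) (sym (u-v≡0⇒u≡v (trans
      (cong (ap M (ap -A⁻¹ v) +ᵛ_) (trans (sym (ap--A (ap -A⁻¹ v))) (-A-A⁻¹ v))) e))))

  open SemiringSum (𝔽ᵣ.semiring {p}) using (*-distribˡ-sum; *-distribʳ-sum)
  open MonoidSum (𝔽ᵣ.+-commutativeMonoid {p}) using (∑-distrib-+; ∑-comm) renaming (sum-cong-≗ to ∑-cong; sum-replicate-zero to ∑-zero)

  tabulate-+ : ∀ {n} (f g : Fin n → 𝔽 p) → tabulate f +ᵛ tabulate g ≡ tabulate (λ i → f i +ᶠ g i)
  tabulate-+ {zero}  f g = refl
  tabulate-+ {suc n} f g = cong (f Fin.zero +ᶠ g Fin.zero ∷_) (tabulate-+ (f ∘ Fin.suc) (g ∘ Fin.suc))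

  matˡ : Matrix p d → Lin p d d
  matˡ M = record
    { ap   = _·ᵐ M
    ; ap-+ = λ u v → trans (Vec.tabulate-cong λ j → trans
        (∑-cong λ i → trans (cong (_*ᶠ M i j) (Vec.lookup-zipWith _+ᶠ_ i u v)) (𝔽ᵣ.distribʳ (M i j) (lookup u i) (lookup v i)))
        (∑-distrib-+ (λ i → lookup u i *ᶠ M i j) (λ i → lookup v i *ᶠ M i j)))
        (sym (tabulate-+ (λ j → ∑ᶠ λ i → lookup u i *ᶠ M i j) (λ j → ∑ᶠ λ i → lookup v i *ᶠ M i j)))
    ; ap-· = λ c v → trans (Vec.tabulate-cong λ j → trans
        (∑-cong λ i → trans (cong (_*ᶠ M i j) (Vec.lookup-map i (c *ᶠ_) v)) (*ᶠ-assoc c (lookup v i) (M i j)))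
        (sym (*-distribˡ-sum c (λ i → lookup v i *ᶠ M i j))))
        (Vec.tabulate-∘ (c *ᶠ_) (λ j → ∑ᶠ λ i → lookup v i *ᶠ M i j)) }

  ∑-single : ∀ {n} (j : Fin n) (f : Fin n → 𝔽 p) → (∀ i → i ≢ j → f i ≡ 0ᶠ) → ∑ᶠ f ≡ f j
  ∑-single {suc n} Fin.zero f e = trans (cong (f Fin.zero +ᶠ_) (trans (∑-cong λ i → e (Fin.suc i) λ ()) (∑-zero n))) (𝔽ᵣ.+-identityʳ (f Fin.zero))
  ∑-single (Fin.suc j) f e = trans (cong₂ _+ᶠ_ (e Fin.zero λ ()) (∑-single j (f ∘ Fin.suc) λ i i≢j → e (Fin.suc i) (i≢j ∘ Fin.suc-injective)))
    (+ᶠ-identityˡ (f (Fin.suc j)))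

  1ᵐ-diagonal : ∀ (j : Fin d) → 1ᵐ {p} j j ≡ 1ᶠ
  1ᵐ-diagonal j with j Fin.≟ j
  ... | yes _ = refl
  ... | no ne = contradiction refl ne

  1ᵐ-offDiagonal : ∀ {i j : Fin d} → i ≢ j → 1ᵐ {p} i j ≡ 0ᶠ
  1ᵐ-offDiagonal {i} {j} i≢j with i Fin.≟ j
  ... | yes e = contradiction e i≢j
  ... | no _  = refl

  ·ᵐ-inverse : ∀ (M N : Matrix p d) → (∀ i j → (M *ᵐ N) i j ≡ 1ᵐ i j) → ∀ u → (u ·ᵐ M) ·ᵐ N ≡ u
  ·ᵐ-inverse M N MN≡1 u = trans (Vec.tabulate-cong entry) (Vec.tabulate∘lookup u)
    where
    open ≡-Reasoning
    entry : ∀ j → ∑ᶠ (λ k → lookup (u ·ᵐ M) k *ᶠ N k j) ≡ lookup u j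
    entry j = begin
      ∑ᶠ (λ k → lookup (u ·ᵐ M) k *ᶠ N k j)                  ≡⟨ ∑-cong (λ k → trans (cong (_*ᶠ N k j) (Vec.lookup∘tabulate (λ k → ∑ᶠ λ i → lookup u i *ᶠ M i k) k)) (*-distribʳ-sum (N k j) (λ i → lookup u i *ᶠ M i k))) ⟩
      ∑ᶠ (λ k → ∑ᶠ λ i → lookup u i *ᶠ M i k *ᶠ N k j)       ≡⟨ ∑-comm (λ k i → lookup u i *ᶠ M i k *ᶠ N k j) ⟩
      ∑ᶠ (λ i → ∑ᶠ λ k → lookup u i *ᶠ M i k *ᶠ N k j)       ≡⟨ ∑-cong (λ i → ∑-cong λ k → *ᶠ-assoc (lookup u i) (M i k) (N k j)) ⟩
      ∑ᶠ (λ i → ∑ᶠ λ k → lookup u i *ᶠ (M i k *ᶠ N k j))     ≡⟨ ∑-cong (λ i → sym (*-distribˡ-sum (lookup u i) (λ k → M i k *ᶠ N k j))) ⟩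
      ∑ᶠ (λ i → lookup u i *ᶠ (M *ᵐ N) i j)                  ≡⟨ ∑-cong (λ i → cong (lookup u i *ᶠ_) (MN≡1 i j)) ⟩
      ∑ᶠ (λ i → lookup u i *ᶠ 1ᵐ i j)                        ≡⟨ ∑-single j _ (λ i i≢j → trans (cong (lookup u i *ᶠ_) (1ᵐ-offDiagonal i≢j)) (𝔽ᵣ.zeroʳ (lookup u i))) ⟩
      lookup u j *ᶠ 1ᵐ j j                                   ≡⟨ trans (cong (lookup u j *ᶠ_) (1ᵐ-diagonal j)) (𝔽ᵣ.*-identityʳ (lookup u j)) ⟩
      lookup u j                                             ∎

  GL⇒trivialKernel : ∀ M → M ∈ GL d p → TrivialKernel (matˡ M)
  GL⇒trivialKernel M (N , MN≡1 , _) u e = trans (sym (·ᵐ-inverse M N MN≡1 u)) (trans (cong (_·ᵐ N) e) (ap-0 (matˡ N)))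

  CGL⇒noEigenvalue-1 : ∀ M → M ∈ CGL d p → NoEigenvalue-1 (matˡ M)
  CGL⇒noEigenvalue-1 M (_ , ¬eig) u e with u ≟ᵛ 0ᵛ
  ... | yes u≡0 = u≡0
  ... | no u≢0  = contradiction (u , u≢0 , trans (𝔽ᵥₚ.inverseˡ-unique (u ·ᵐ M) u e) (sym (-1·ᵛ u))) ¬eig

-- Members of `Γ` as cycle types of products

module _ {p : ℕ} .{{_ : NonZero p}} {n : ℕ} {σ : 𝔽[ p ]^ n → 𝔽[ p ]^ n} (σ-injective : Injective _≡_ _≡_ σ) where

  module CyclesOfᵛ = CyclesOf _≟ᵛ_ (allVectors p n) ∈-allVectors σ σ-injective

affine-injective : ∀ {p d} .{{_ : NonZero p}} (M : Lin p d d) → TrivialKernel M → ∀ v → Injective _≡_ _≡_ (λ u → ap M u +ᵛ v)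
affine-injective M M-tk v {a} {b} e = trivialKernel⇒injective M M-tk (𝔽ᵥₚ.∙-cancelʳ v (ap M a) (ap M b) e)

-- The permutation is kept apart from the product, since `Γ` supplies it as a function of its own
-- that agrees with the product only pointwise.
record IsProductType (d p : ℕ) .{{_ : NonZero p}} (ℓ : ℕ) (γ : ℚ[x]) : Set where
  field
    permutation : 𝔽[ p ]^ d → 𝔽[ p ]^ d
    factors     : ℕ → CompleteAffine p d
    product     : ∀ u → run factors ℓ u ≡ permutation u
    type        : γ ≈ CT permutation

noEigenvalue-1? : ∀ {p d} .{{_ : NonZero p}} (f : Lin p d d) → Dec (NoEigenvalue-1 f)
noEigenvalue-1? f = all-vectors? λ u → ((ap f u +ᵛ u) ≟ᵛ 0ᵛ) →-dec (u ≟ᵛ 0ᵛ)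

factorable⇒isProductType : ∀ {d p} .{{_ : NonZero p}} {S : Lin p d d → Set} → Factorable S →
  ∀ {ℓ γ} → ℓ ℕ.≥ 2 → ∀ M → S M → ∀ v → γ ≈ CT (λ u → ap M u +ᵛ v) → IsProductType d p ℓ γ
factorable⇒isProductType fac {ℓ = suc (suc n)} (s≤s (s≤s z≤n)) M SM v e = record
  { permutation = λ u → ap M u +ᵛ v ; factors = proj₁ prod ; product = proj₂ prod ; type = e }
  where prod = factorable⇒isProduct fac M SM v n

module Case-1-3 where

  Identity : Lin 3 1 1 → Set
  Identity M = ∀ u → ap M u ≡ u

  id-tk : TrivialKernel (idˡ {3} {n = 1})
  id-tk _ e = e

  id-ne : NoEigenvalue-1 (idˡ {3} {n = 1})
  id-ne = fromTrue (noEigenvalue-1? (idˡ {3} {n = 1})) refl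

  -- Over 𝔽₃ the scalar 1 differs from 0 and from -1 = 2, so the identity is an admissible factor of
  -- itself. The available permutations are the translations, and those by 0 and 1 have the two
  -- listed types.
  identity-factorable : Factorable Identity
  identity-factorable M M≗1 = idˡ , idˡ , id-tk , id-ne , id-tk , id-ne , (λ _ → refl) , λ u → sym (M≗1 u)

  translation : 𝔽 3 → 𝔽[ 3 ]^ 1 → 𝔽[ 3 ]^ 1
  translation a u = u +ᵛ (a ∷ [])

  CT-translation : ∀ a L → map (CyclesOfᵛ.per (affine-injective (idˡ {3} {n = 1}) id-tk (a ∷ []))) (CyclesOfᵛ.representatives (affine-injective (idˡ {3} {n = 1}) id-tk (a ∷ []))) ≡ L →
    monomial L ≈ CT (translation a)
  CT-translation a L refl = ≈-sym (CyclesOfᵛ.cycleType-representatives (affine-injective (idˡ {3} {n = 1}) id-tk (a ∷ [])))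

  isProductType : ∀ {ℓ γ} → ℓ ℕ.≥ 2 → γ ≈ monomial (1 ∷ 1 ∷ 1 ∷ []) ⊎ γ ≈ x 3 → IsProductType 1 3 ℓ γ
  isProductType ℓ≥2 (inj₁ e) = factorable⇒isProductType identity-factorable ℓ≥2 idˡ (λ _ → refl) (0F ∷ [])
    (≈-trans e (CT-translation 0F _ refl))
  isProductType ℓ≥2 (inj₂ e) = factorable⇒isProductType identity-factorable ℓ≥2 idˡ (λ _ → refl) (1F ∷ [])
    (≈-trans e (≈-trans (≈-trans (≈-sym (*-identityˡ (x 3))) (*-comm _ _)) (CT-translation 1F (3 ∷ []) refl)))

module Case-2-2 where

  ω^ : Fin 3 → Lin 2 2 2
  ω^ 0F = idˡ
  ω^ 1F = comb ω
  ω^ 2F = comb ω²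

  PowerOfω : Lin 2 2 2 → Set
  PowerOfω M = Σ[ i ∈ Fin 3 ] (∀ u → ap (ω^ i) u ≡ ap M u)

  ω^-tk : ∀ i → TrivialKernel (ω^ i)
  ω^-tk 0F = λ _ e → e
  ω^-tk 1F = fromTrue (agreeOnlyAt0? (comb ω) zeroˡ) refl
  ω^-tk 2F = fromTrue (agreeOnlyAt0? (comb ω²) zeroˡ) refl

  ω-ne : NoEigenvalue-1 (comb ω)
  ω-ne = fromTrue (noEigenvalue-1? (comb ω)) refl

  ω²-ne : NoEigenvalue-1 (comb ω²)
  ω²-ne = fromTrue (noEigenvalue-1? (comb ω²)) refl

  -- The admissible factors are `ω` and `ω²`, and each element of the group of order 3 is a product
  -- of two of them: 1 = `ω` `ω²`, `ω` = `ω²` `ω²`, `ω²` = `ω` `ω`. Translations give the types of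
  -- four fixed points and of two transpositions, and `ω` itself fixes 0 and permutes the other
  -- three vectors.
  powers-factorable : Factorable PowerOfω
  powers-factorable M (0F , e) = comb ω , comb ω² , ω^-tk 1F , ω-ne , ω^-tk 2F , ω²-ne , (2F , λ _ → refl)
    , λ u → trans (fromTrue (all-vectors? λ u → ap (comb ω²) (ap (comb ω) u) ≟ᵛ u) refl u) (e u)
  powers-factorable M (1F , e) = comb ω² , comb ω² , ω^-tk 2F , ω²-ne , ω^-tk 2F , ω²-ne , (2F , λ _ → refl)
    , λ u → trans (fromTrue (all-vectors? λ u → ap (comb ω²) (ap (comb ω²) u) ≟ᵛ ap (comb ω) u) refl u) (e u)
  powers-factorable M (2F , e) = comb ω , comb ω , ω^-tk 1F , ω-ne , ω^-tk 1F , ω-ne , (1F , λ _ → refl)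
    , λ u → trans (fromTrue (all-vectors? λ u → ap (comb ω) (ap (comb ω) u) ≟ᵛ ap (comb ω²) u) refl u) (e u)

  CT-affine : ∀ i v L → map (CyclesOfᵛ.per (affine-injective (ω^ i) (ω^-tk i) v)) (CyclesOfᵛ.representatives (affine-injective (ω^ i) (ω^-tk i) v)) ≡ L →
    monomial L ≈ CT (λ u → ap (ω^ i) u +ᵛ v)
  CT-affine i v L refl = ≈-sym (CyclesOfᵛ.cycleType-representatives (affine-injective (ω^ i) (ω^-tk i) v))

  isProductType : ∀ {ℓ γ} → ℓ ℕ.≥ 2 → γ ≈ monomial (1 ∷ 1 ∷ 1 ∷ 1 ∷ []) ⊎ γ ≈ monomial (2 ∷ 2 ∷ []) ⊎ γ ≈ x 1 * x 3 → IsProductType 2 2 ℓ γ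
  isProductType ℓ≥2 (inj₁ e) = factorable⇒isProductType powers-factorable ℓ≥2 (ω^ 0F) (0F , λ _ → refl) (0F ∷ 0F ∷ [])
    (≈-trans e (CT-affine 0F (0F ∷ 0F ∷ []) _ refl))
  isProductType ℓ≥2 (inj₂ (inj₁ e)) = factorable⇒isProductType powers-factorable ℓ≥2 (ω^ 0F) (0F , λ _ → refl) (0F ∷ 1F ∷ [])
    (≈-trans e (CT-affine 0F (0F ∷ 1F ∷ []) _ refl))
  isProductType ℓ≥2 (inj₂ (inj₂ e)) = factorable⇒isProductType powers-factorable ℓ≥2 (ω^ 1F) (1F , λ _ → refl) (0F ∷ 0F ∷ [])
    (≈-trans e (≈-trans (*-cong ≈-refl (≈-trans (≈-sym (*-identityˡ (x 3))) (*-comm _ _))) (CT-affine 1F (0F ∷ 0F ∷ []) (1 ∷ 3 ∷ []) refl)))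

-- The case distinction in `Γ` is consumed here: the construction sees only products of ℓ complete
-- affine maps. For ℓ = 1 the single factor is the given permutation itself.
Γ⇒isProductType : ∀ {d p ℓ γ} .{{_ : NonZero d}} .{{_ : NonZero p}} → Prime p → Γ d p ℓ γ → IsProductType d p ℓ γ
Γ⇒isProductType {d} {p} p-prime (Γ-one refl (σ , (M , v , M∈CGL@(M∈GL , _) , σ≗) , e)) = record
  { permutation = σ
  ; factors = λ _ → completeAffine (matˡ M) (GL⇒trivialKernel M M∈GL) (CGL⇒noEigenvalue-1 M M∈CGL) v
  ; product = λ u → sym (σ≗ u)
  ; type = e }
Γ⇒isProductType {d} {p} {suc (suc n)} p-prime (Γ-generic (s≤s (s≤s z≤n)) ¬12 ¬13 ¬22 (σ , (M , v , M∈GL , σ≗) , e)) = record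
  { permutation = σ
  ; factors = proj₁ prod
  ; product = λ u → trans (proj₂ prod u) (sym (σ≗ u))
  ; type = e }
  where prod = factorable⇒isProduct (allAvoidable⇒factorable (allAvoidable d p p-prime ¬12 ¬13 ¬22)) (matˡ M) (GL⇒trivialKernel M M∈GL) v n
Γ⇒isProductType _ (Γ-1,3 ℓ≥2 refl refl e) = Case-1-3.isProductType ℓ≥2 e
Γ⇒isProductType _ (Γ-2,2 ℓ≥2 refl refl e) = Case-2-2.isProductType ℓ≥2 e

-- Naming the cycles of the base permutation

length-filter-map : ∀ {A B : Set} {P : B → Set} (P? : Decidable P) (h : A → B) xs →
                    length (filter P? (map h xs)) ≡ length (filter (P? ∘ h) xs)
length-filter-map P? h []       = refl
length-filter-map P? h (a ∷ xs) with does (P? (h a))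
... | true  = cong suc (length-filter-map P? h xs)
... | false = length-filter-map P? h xs

unrelated-lookup : ∀ {A : Set} {R : Rel A 0ℓ} → Symmetric R → ∀ {xs} → AllPairs (λ a b → ¬ R a b) xs →
                   ∀ i j → R (List.lookup xs i) (List.lookup xs j) → i ≡ j
unrelated-lookup sy (_ ∷ _)  Fin.zero    Fin.zero    _ = refl
unrelated-lookup sy (p ∷ _)  Fin.zero    (Fin.suc j) r = contradiction r (All.lookup p (∈-lookup j))
unrelated-lookup sy (p ∷ _)  (Fin.suc i) Fin.zero    r = contradiction (sy r) (All.lookup p (∈-lookup i))
unrelated-lookup sy (_ ∷ ps) (Fin.suc i) (Fin.suc j) r = cong Fin.suc (unrelated-lookup sy ps i j r)

-- A bijection between `I` and the cycles of `g`, with a starting point on each. It lets the double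
-- index of `γ` name a cycle.
record CycleIndexing {Y : Set} (g : Y → Y) {I : Set} (len : I → ℕ) : Set where
  field
    rep        : I → Y
    rep-period : ∀ i → IsPeriod g (rep i) (len i)
    rep-cover  : ∀ y → ∃[ i ] SameCycle g (rep i) y
    rep-unique : ∀ {i j} → SameCycle g (rep i) (rep j) → i ≡ j

length-allVectors : ∀ p n → length (allVectors p n) ≡ p ℕ.^ n
length-allVectors p n = trans (List.length-map (decode {p} n) (List.allFin (p ℕ.^ n))) (List.length-tabulate {n = p ℕ.^ n} id)

-- `CT` multiplies over the length of the list of all vectors, which equals `p ℕ.^ n` only
-- propositionally; the exponents in the theorem are indexed by the latter.
CT-∏ : ∀ {p n} (σ : 𝔽[ p ]^ n → 𝔽[ p ]^ n) →
       CT σ ≈ ∏ {p ℕ.^ n} (λ j → x ⟦ j ⟧ ^ Cycles.cycleCount _≟ᵛ_ (allVectors p n) σ ⟦ j ⟧)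
CT-∏ {p} {n} σ = reindex {a = Cycles.cycleCount _≟ᵛ_ (allVectors p n) σ} (length-allVectors p n)
  where
  reindex : ∀ {l m} {a : ℕ → ℕ} → l ≡ m → ∏ {l} (λ j → x ⟦ j ⟧ ^ a ⟦ j ⟧) ≈ ∏ {m} (λ j → x ⟦ j ⟧ ^ a ⟦ j ⟧)
  reindex refl = ≈-refl

module _ {p t : ℕ} .{{_ : NonZero p}} (g : 𝔽[ p ]^ t → 𝔽[ p ]^ t) (g-injective : Injective _≡_ _≡_ g)
         (k : Fin (p ℕ.^ t) → ℕ) (CT-g : CT g ≈ ∏ (λ ℓ → x ⟦ ℓ ⟧ ^ k ℓ)) where

  open CyclesOfᵛ g-injective

  private
    block : Fin (p ℕ.^ t) → List (𝔽[ p ]^ t)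
    block ℓ = filter (λ τ → per τ ℕ.≟ ⟦ ℓ ⟧) representatives

    length-block : ∀ ℓ → k ℓ ≡ length (block ℓ)
    length-block ℓ = trans (∏-exponents {k = k} {l = λ j → Cycles.cycleCount _≟ᵛ_ (allVectors p t) g ⟦ j ⟧} (≈-trans (≈-sym CT-g) (CT-∏ g)) ℓ)
      (length-filter-map (λ c → length c ℕ.≟ ⟦ ℓ ⟧) (Cycles.cycle _≟ᵛ_ (allVectors p t) g) representatives)

  -- Equal monomials have equal exponents, so `k ℓ` is the number of representatives of period
  -- `⟦ ℓ ⟧`. The pair `(ℓ , i)` names the representative at position `i` among these.
  cycleIndexing : CycleIndexing g {Σ[ ℓ ∈ Fin (p ℕ.^ t) ] Fin (k ℓ)} (λ (ℓ , _) → ⟦ ℓ ⟧)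
  cycleIndexing = record { rep = rep ; rep-period = rep-period ; rep-cover = rep-cover ; rep-unique = rep-unique }
    where
    rep : Σ[ ℓ ∈ Fin (p ℕ.^ t) ] Fin (k ℓ) → 𝔽[ p ]^ t
    rep (ℓ , i) = List.lookup (block ℓ) (cast (length-block ℓ) i)
    per-rep : ∀ i → per (rep i) ≡ ⟦ proj₁ i ⟧
    per-rep (ℓ , i) = proj₂ (∈-filter⁻ (λ τ → per τ ℕ.≟ ⟦ ℓ ⟧) {xs = representatives} (∈-lookup {xs = block ℓ} (cast (length-block ℓ) i)))
    rep-period : ∀ i → IsPeriod g (rep i) ⟦ proj₁ i ⟧
    rep-period i = subst (IsPeriod g (rep i)) (per-rep i) (per-isPeriod (rep i))
    rep-cover : ∀ y → ∃[ i ] SameCycle g (rep i) y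
    rep-cover y = (ℓ , i) , subst (λ z → SameCycle g z y) (sym rep-τ) same
      where
      covered = proj₂ representatives-transversal y
      τ = proj₁ covered
      same = proj₂ (proj₂ covered)
      ℓ,e = per-index τ
      ℓ = cast (length-allVectors p t) (proj₁ ℓ,e)
      τ∈ : τ ∈ˡ block ℓ
      τ∈ = ∈-filter⁺ (λ τ → per τ ℕ.≟ ⟦ ℓ ⟧) (proj₁ (proj₂ covered))
        (trans (proj₂ ℓ,e) (cong suc (sym (Fin.toℕ-cast (length-allVectors p t) (proj₁ ℓ,e)))))
      i = cast (sym (length-block ℓ)) (Any.index τ∈)
      rep-τ : rep (ℓ , i) ≡ τ
      rep-τ = trans (cong (List.lookup (block ℓ)) (Fin.cast-involutive (length-block ℓ) (sym (length-block ℓ)) (Any.index τ∈)))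
        (sym (Any.lookup-index τ∈))
    same-block : ∀ {ℓ ℓ′} → ℓ ≡ ℓ′ → ∀ i j → SameCycle g (rep (ℓ , i)) (rep (ℓ′ , j)) → (ℓ , i) ≡ (ℓ′ , j)
    same-block {ℓ} refl i j s = cong (ℓ ,_) (Fin.toℕ-injective (trans (sym (Fin.toℕ-cast (length-block ℓ) i)) (trans
      (cong toℕ (unrelated-lookup SameCycle-sym (AllPairs.filter⁺ (λ τ → per τ ℕ.≟ ⟦ ℓ ⟧) (proj₁ representatives-transversal))
        (cast (length-block ℓ) i) (cast (length-block ℓ) j) s)) (Fin.toℕ-cast (length-block ℓ) j))))
    rep-unique : ∀ {i j} → SameCycle g (rep i) (rep j) → i ≡ j
    rep-unique {ℓ , i} {ℓ′ , j} s = same-block (Fin.toℕ-injective (ℕ.suc-injective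
      (trans (sym (per-rep (ℓ , i))) (trans (per-cong s) (per-rep (ℓ′ , j)))))) i j s

-- Skew products over a permutation

module SkewProduct {p d t : ℕ} .{{_ : NonZero p}} {g : 𝔽[ p ]^ t → 𝔽[ p ]^ t} (g-injective : Injective _≡_ _≡_ g)
                   {I : Set} {len : I → ℕ} (indexing : CycleIndexing g len)
                   (α : I → ℕ → CompleteAffine p d) where

  open CycleIndexing indexing
  open CyclesOfᵛ g-injective using (SameCycle-sym; SameCycle-trans)

  σ : I → 𝔽[ p ]^ d → 𝔽[ p ]^ d
  σ i = run (α i) (len i)

  Location : 𝔽[ p ]^ t → Set
  Location y = Σ[ i ∈ I ] Σ[ s ∈ ℕ ] s < len i × iter g s (rep i) ≡ y

  locate : ∀ y → Location y
  locate y = i , n % len i , m%n<n n (len i) , trans (sym (iter-% {ℓ = len i} (returns (rep-period i)) n)) (proj₂ (proj₂ (rep-cover y)))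
    where
    i = proj₁ (rep-cover y)
    n = proj₁ (proj₂ (rep-cover y))
    instance _ = nonZero (rep-period i)

  factorAt : ∀ {y} → Location y → CompleteAffine p d
  factorAt (i , s , _) = α i s

  fibreMap : 𝔽[ p ]^ t → CompleteAffine p d
  fibreMap y = factorAt (locate y)

  skew : 𝔽[ p ]^ d × 𝔽[ p ]^ t → 𝔽[ p ]^ d × 𝔽[ p ]^ t
  skew (w , y) = act (fibreMap y) w , g y

  -- A point lies on one cycle only, and the iterates of its starting point within one period are
  -- distinct. Hence the factor at `iter g s (rep i)` is `α i s`, whichever location `locate`
  -- returns.
  factorAt-unique : ∀ {y} (l l′ : Location y) → factorAt l ≡ factorAt l′
  factorAt-unique (i , s , s<len , e) (j , s′ , s′<len , e′) =
    same-rep (rep-unique (SameCycle-trans (s , e) (SameCycle-sym (s′ , e′)))) s<len s′<len (trans e (sym e′))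
    where
    same-rep : ∀ {i j s s′} → i ≡ j → s < len i → s′ < len j → iter g s (rep i) ≡ iter g s′ (rep j) → α i s ≡ α j s′
    same-rep {i} {s = s} {s′} refl s<len s′<len e with ℕ.<-cmp s s′
    ... | tri< s<s′ _ _ = contradiction e (iter-distinct g-injective (rep-period i) s<s′ s′<len)
    ... | tri≈ _ refl _ = refl
    ... | tri> _ _ s′<s = contradiction (sym e) (iter-distinct g-injective (rep-period i) s′<s s<len)

  fibreMap-iter : ∀ i s → s < len i → fibreMap (iter g s (rep i)) ≡ α i s
  fibreMap-iter i s s<len = factorAt-unique (locate (iter g s (rep i))) (i , s , s<len , refl)

  skew-injective : Injective _≡_ _≡_ skew
  skew-injective {w , y} {w′ , y′} e with g-injective (cong proj₂ e)
  ... | refl = cong (_, y) (act-injective (fibreMap y) (cong proj₁ e))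

  proj₂-iter : ∀ n z → proj₂ (iter skew n z) ≡ iter g n (proj₂ z)
  proj₂-iter = iter-semiconj skew g proj₂ (λ _ → refl)

  iter-along : ∀ i s w → s ≤ len i → iter skew s (w , rep i) ≡ (run (α i) s w , iter g s (rep i))
  iter-along i zero    w _     = refl
  iter-along i (suc s) w s<len = trans (iter-suc skew s (w , rep i)) (trans (cong skew (iter-along i s w (ℕ.<⇒≤ s<len)))
    (cong₂ _,_ (cong (λ a → act a (run (α i) s w)) (fibreMap-iter i s s<len)) (sym (iter-suc g s (rep i)))))

  -- One full turn around the base cycle applies its factors in order, so `σ i` is the first-return
  -- map to the fibre over `rep i`.
  iter-return : ∀ i q w → iter skew (q ℕ.* len i) (w , rep i) ≡ (iter (σ i) q w , rep i)
  iter-return i zero    w = refl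
  iter-return i (suc q) w = trans (iter-+ skew (len i) (q ℕ.* len i) (w , rep i))
    (trans (cong (iter skew (q ℕ.* len i)) (trans (iter-along i (len i) w ℕ.≤-refl) (cong (σ i w ,_) (returns (rep-period i)))))
      (iter-return i q (σ i w)))

  -- Projecting to the base shows that a return time is a multiple of `len i`, and the quotient is a
  -- return time of `σ i`. This is the source of the substitution made by `BU`.
  skew-period : ∀ i {w m} → IsPeriod (σ i) w m → IsPeriod skew (w , rep i) (len i ℕ.* m)
  skew-period i {w} {m} m-per = record
    { nonZero = ℕ.m*n≢0 (len i) m {{nonZero (rep-period i)}} {{nonZero m-per}}
    ; returns = trans (cong (λ n → iter skew n (w , rep i)) (ℕ.*-comm (len i) m))
                  (trans (iter-return i m w) (cong (_, rep i) (returns m-per)))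
    ; minimal = min }
    where
    min : ∀ n → iter skew n (w , rep i) ≡ (w , rep i) → len i ℕ.* m ∣ n
    min n e with minimal (rep-period i) n (trans (sym (proj₂-iter n (w , rep i))) (cong proj₂ e))
    ... | divides q refl = subst (len i ℕ.* m ∣_) (ℕ.*-comm (len i) q)
      (*-monoʳ-∣ (len i) (minimal m-per q (trans (cong proj₁ (sym (iter-return i q w))) (cong proj₁ e))))

  -- The base coordinates force `i ≡ j`. The number of steps is then a multiple of `len i`, so the
  -- motion in the fibre is a power of the first-return map.
  skew-unrelated : ∀ {i j w w′} → SameCycle skew (w , rep i) (w′ , rep j) → Σ[ e ∈ i ≡ j ] SameCycle (σ i) w w′
  skew-unrelated {i} {j} {w} (n , e)
    with rep-unique (n , trans (sym (proj₂-iter n (w , rep i))) (cong proj₂ e))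
  ... | refl with minimal (rep-period i) n (trans (sym (proj₂-iter n (w , rep i))) (cong proj₂ e))
  ...   | divides q refl = refl , q , trans (cong proj₁ (sym (iter-return i q w))) (cong proj₁ e)

  -- A point is moved back to the fibre over rep i by inverting the first s factors.
  skew-covers : (T : I → List (𝔽[ p ]^ d)) → (∀ i → Transversal (σ i) (T i)) →
                ∀ z → ∃[ i ] ∃[ w ] w ∈ˡ T i × SameCycle skew (w , rep i) z
  skew-covers T T-transversal (w , y) with i , s , s<len , refl ← locate y
    with w₀ , refl ← injective⇒onto (run (α i) s) (run-injective (α i) s) w
    with τ , τ∈ , q , refl ← proj₂ (T-transversal i) w₀
    = i , τ , τ∈ , q ℕ.* len i ℕ.+ s , trans (iter-+ skew (q ℕ.* len i) s (τ , rep i))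
        (trans (cong (iter skew s) (iter-return i q τ)) (iter-along i s (iter (σ i) q τ) (ℕ.<⇒≤ s<len)))

-- Concatenated families, pointwise equality and conjugation

module _ {A : Set} where

  concatTabulate : ∀ {n} → (Fin n → List A) → List A
  concatTabulate L = concat (List.tabulate L)

  ∈-concatTabulate⁺ : ∀ {n} (L : Fin n → List A) i {a} → a ∈ˡ L i → a ∈ˡ concatTabulate L
  ∈-concatTabulate⁺ L i a∈ = ∈-concat⁺′ a∈ (∈-tabulate⁺ i)

  ∈-concatTabulate⁻ : ∀ {n} (L : Fin n → List A) {a} → a ∈ˡ concatTabulate L → ∃[ i ] a ∈ˡ L i
  ∈-concatTabulate⁻ L a∈ with _ , a∈′ , L∈ ← ∈-concat⁻′ (List.tabulate L) a∈ with i , refl ← ∈-tabulate⁻ L∈ = i , a∈′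

  concatTabulate-unrelated : ∀ {n} {R : Rel A 0ℓ} (L : Fin n → List A) → (∀ i → AllPairs R (L i)) →
    (∀ {i j} → i ≢ j → ∀ {a b} → a ∈ˡ L i → b ∈ˡ L j → R a b) → AllPairs R (concatTabulate L)
  concatTabulate-unrelated L within across = AllPairs.concat⁺ (All.tabulate⁺ within)
    (AllPairs.tabulate⁺ λ i≢j → All.tabulate λ a∈ → All.tabulate λ b∈ → across i≢j a∈ b∈)

map-concatTabulate : ∀ {A B : Set} (h : A → B) {n} (L : Fin n → List A) →
                     map h (concatTabulate L) ≡ concatTabulate (map h ∘ L)
map-concatTabulate h L = trans (sym (List.concat-map (List.tabulate L))) (cong concat (List.map-tabulate L (map h)))

-- Pointwise equal functions need not be identical, so the argument goes through orbits: they have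
-- the same iterates, hence the same periods, and the representatives for `σ` also serve for `τ`.
CT-cong : ∀ {p n} .{{_ : NonZero p}} {σ τ : 𝔽[ p ]^ n → 𝔽[ p ]^ n} → Injective _≡_ _≡_ σ → (∀ u → σ u ≡ τ u) → CT σ ≈ CT τ
CT-cong {σ = σ} {τ} σ-inj σ≗τ = ≈-trans (C.cycleType-representatives)
  (≈-trans (ℚ[X].reflexive (cong monomial (List.map-cong (λ u → period-unique (C.per-isPeriod u) (conv (D.per-isPeriod u))) C.representatives)))
    (≈-sym (D.cycleType-transversal C.representatives
      (AllPairs.map (λ ¬s (m , e) → ¬s (m , trans (same m _) e)) (proj₁ C.representatives-transversal)
      , λ u → let r , r∈ , m , e = proj₂ C.representatives-transversal u in r , r∈ , m , trans (sym (same m r)) e))))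
  where
  τ-inj : Injective _≡_ _≡_ τ
  τ-inj {u} {v} e = σ-inj (trans (σ≗τ u) (trans e (sym (σ≗τ v))))
  module C = CyclesOfᵛ σ-inj
  module D = CyclesOfᵛ τ-inj
  same : ∀ m u → iter σ m u ≡ iter τ m u
  same m u = iter-semiconj σ τ id σ≗τ m u
  conv : ∀ {u m} → IsPeriod τ u m → IsPeriod σ u m
  conv {u} {m} m-per = record
    { nonZero = nonZero m-per ; returns = trans (same m u) (returns m-per) ; minimal = λ n e → minimal m-per n (trans (sym (same n u)) e) }

module Conjugation {Z V : Set} (Ψ : Z → V) (Φ : V → Z) (Ψ-Φ : ∀ v → Ψ (Φ v) ≡ v) (Φ-Ψ : ∀ z → Φ (Ψ z) ≡ z) (s : Z → Z) where

  conjugate : V → V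
  conjugate v = Ψ (s (Φ v))

  Ψ-injective : Injective _≡_ _≡_ Ψ
  Ψ-injective {z} {z′} e = trans (sym (Φ-Ψ z)) (trans (cong Φ e) (Φ-Ψ z′))

  Φ-injective : Injective _≡_ _≡_ Φ
  Φ-injective {u} {v} e = trans (sym (Ψ-Φ u)) (trans (cong Ψ e) (Ψ-Φ v))

  conjugate-injective : Injective _≡_ _≡_ s → Injective _≡_ _≡_ conjugate
  conjugate-injective s-injective e = Φ-injective (s-injective (Ψ-injective e))

  iter-conjugate : ∀ n z → iter conjugate n (Ψ z) ≡ Ψ (iter s n z)
  iter-conjugate n z = sym (iter-semiconj s conjugate Ψ (λ z → cong (Ψ ∘ s) (sym (Φ-Ψ z))) n z)

  conjugate-period : ∀ z m → IsPeriod s z m → IsPeriod conjugate (Ψ z) m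
  conjugate-period z m m-per = record
    { nonZero = nonZero m-per
    ; returns = trans (iter-conjugate m z) (cong Ψ (returns m-per))
    ; minimal = λ n e → minimal m-per n (Ψ-injective (trans (sym (iter-conjugate n z)) e)) }

  SameCycle-conjugate⁻ : ∀ z z′ → SameCycle conjugate (Ψ z) (Ψ z′) → SameCycle s z z′
  SameCycle-conjugate⁻ z z′ (n , e) = n , Ψ-injective (trans (sym (iter-conjugate n z)) e)

  SameCycle-conjugate⁺ : ∀ z v → SameCycle s z (Φ v) → SameCycle conjugate (Ψ z) v
  SameCycle-conjugate⁺ z v (n , e) = n , trans (iter-conjugate n z) (trans (cong Ψ e) (Ψ-Φ v))

-- The complete mapping in coordinates adapted to `W`

module Construction {p d t : ℕ} .{{_ : NonZero p}} (p-prime : Prime p)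
  {g : 𝔽[ p ]^ t → 𝔽[ p ]^ t} (g-complete : IsCompleteMapping _+ᵛ_ g)
  {k : Fin (p ℕ.^ t) → ℕ} (CT-g : CT g ≈ ∏ (λ ℓ → x ⟦ ℓ ⟧ ^ k ℓ))
  {γ : (ℓ : Fin (p ℕ.^ t)) → Fin (k ℓ) → ℚ[x]} (γ-type : ∀ ℓ i → IsProductType d p ⟦ ℓ ⟧ (γ ℓ i))
  {W : Pred (𝔽[ p ]^ (d ℕ.+ t)) 0ℓ} (W-subspace : IsSubspace W)
  {b : Fin d → 𝔽[ p ]^ (d ℕ.+ t)} (b-basis : IsBasis W b) where

  open IsSubspace W-subspace
  open IsBasis b-basis
  open IsProductType

  V : Set
  V = 𝔽[ p ]^ (d ℕ.+ t)

  B : Lin p d (d ℕ.+ t)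
  B = comb (tabulate b)

  ap-B : ∀ c → ap B c ≡ ∑ᵛ (λ i → lookup c i ·ᵛ b i)
  ap-B c = trans (cong (ap B) (sym (Vec.tabulate∘lookup c))) (comb-∑ b (lookup c))

  B-trivialKernel : TrivialKernel B
  B-trivialKernel c e = trans (sym (Vec.tabulate∘lookup c)) (trans
    (Vec.tabulate-cong (independent (lookup c) (trans (sym (ap-B c)) e))) tabulate-0)
    where
    tabulate-0 : ∀ {n} → tabulate {n = n} (λ _ → 0ᶠ) ≡ 0ᵛ {p}
    tabulate-0 {zero}  = refl
    tabulate-0 {suc n} = cong (0ᶠ ∷_) tabulate-0

  comb∈W : ∀ {m} (bs : Fin m → V) → (∀ i → bs i ∈ W) → ∀ c → ap (comb (tabulate bs)) c ∈ W
  comb∈W bs bs∈ []      = 0ᵛ∈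
  comb∈W bs bs∈ (a ∷ c) = +ᵛ∈ (·ᵛ∈ a (bs∈ Fin.zero)) (comb∈W (bs ∘ Fin.suc) (bs∈ ∘ Fin.suc) c)

  extension : Σ[ h ∈ Lin p (t ℕ.+ d) (d ℕ.+ t) ] TrivialKernel h × (∀ c → ap h (0ᵛ {n = t} ++ c) ≡ ap B c)
  extension = extend p-prime t B B-trivialKernel (ℕ.≤-reflexive (ℕ.+-comm t d))

  H : Lin p (t ℕ.+ d) (d ℕ.+ t)
  H = proj₁ extension

  H-injective : Injective _≡_ _≡_ (ap H)
  H-injective = trivialKernel⇒injective H (proj₁ (proj₂ extension))

  inverse : Σ[ h ∈ Lin p (d ℕ.+ t) (t ℕ.+ d) ] ∀ v → ap H (ap h v) ≡ v
  inverse = invˡ H (proj₁ (proj₂ extension)) (onto (ℕ.+-comm t d) (ap H) H-injective)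
    where
    onto : ∀ {m n} → m ≡ n → (f : 𝔽[ p ]^ m → 𝔽[ p ]^ n) → Injective _≡_ _≡_ f → ∀ v → ∃[ u ] f u ≡ v
    onto refl = injective⇒onto

  H⁻¹ : Lin p (d ℕ.+ t) (t ℕ.+ d)
  H⁻¹ = proj₁ inverse

  -- The `t` vectors completing the basis of `W` come first in `extension`, hence the order
  -- `y ++ w`. The subspace `W` is the part with `y` = 0, and `y` labels its cosets.
  Ψ : 𝔽[ p ]^ d × 𝔽[ p ]^ t → V
  Ψ (w , y) = ap H (y ++ w)

  Φ : V → 𝔽[ p ]^ d × 𝔽[ p ]^ t
  Φ v = drop t (ap H⁻¹ v) , take t (ap H⁻¹ v)

  Ψ-Φ : ∀ v → Ψ (Φ v) ≡ v
  Ψ-Φ v = trans (cong (ap H) (Vec.take++drop≡id t (ap H⁻¹ v))) (proj₂ inverse v)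

  Φ-Ψ : ∀ z → Φ (Ψ z) ≡ z
  Φ-Ψ (w , y) = trans (cong (λ u → drop t u , take t u) (H-injective {ap H⁻¹ (ap H (y ++ w))} {y ++ w} (proj₂ inverse (ap H (y ++ w)))))
    (cong₂ _,_ (drop-++ y w) (take-++ y w))

  Ψ-+ : ∀ w y w′ y′ → Ψ (w , y) +ᵛ Ψ (w′ , y′) ≡ Ψ (w +ᵛ w′ , y +ᵛ y′)
  Ψ-+ w y w′ y′ = trans (sym (ap-+ H (y ++ w) (y′ ++ w′))) (cong (ap H) (+ᵛ-++ y y′ w w′))

  Ψ-0 : ∀ c → Ψ (c , 0ᵛ) ≡ ap B c
  Ψ-0 = proj₂ (proj₂ extension)

  g-injective : Injective _≡_ _≡_ g
  g-injective = proj₁ (proj₁ g-complete)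

  I : Set
  I = Σ[ ℓ ∈ Fin (p ℕ.^ t) ] Fin (k ℓ)

  indexing : CycleIndexing g {I} (λ (ℓ , _) → ⟦ ℓ ⟧)
  indexing = cycleIndexing g g-injective k CT-g

  open CycleIndexing indexing
  open SkewProduct g-injective indexing (λ (ℓ , i) → factors (γ-type ℓ i))

  open Conjugation Ψ Φ Ψ-Φ Φ-Ψ skew public using (Ψ-injective; Φ-injective; conjugate-period; SameCycle-conjugate⁻; SameCycle-conjugate⁺)
    renaming (conjugate to f; conjugate-injective to f-injective′)

  f-injective : Injective _≡_ _≡_ f
  f-injective = f-injective′ skew-injective

  skew+id : 𝔽[ p ]^ d × 𝔽[ p ]^ t → 𝔽[ p ]^ d × 𝔽[ p ]^ t
  skew+id (w , y) = act (fibreMap y) w +ᵛ w , g y +ᵛ y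

  -- Completeness of `g` separates different base points. Over a common base point both arguments
  -- use the same fibre map, which is complete as well.
  skew+id-injective : Injective _≡_ _≡_ skew+id
  skew+id-injective {w , y} {w′ , y′} e = same-fibre (proj₁ (proj₂ g-complete) (cong proj₂ e)) (cong proj₁ e)
    where
    same-fibre : ∀ {y′} → y ≡ y′ → act (fibreMap y) w +ᵛ w ≡ act (fibreMap y′) w′ +ᵛ w′ → (w , y) ≡ (w′ , y′)
    same-fibre refl e = cong (_, y) (act+id-injective (fibreMap y) e)

  f+id : ∀ v → f v +ᵛ v ≡ Ψ (skew+id (Φ v))
  f+id v = trans (cong (f v +ᵛ_) (sym (Ψ-Φ v)))
    (Ψ-+ (proj₁ (skew (Φ v))) (proj₂ (skew (Φ v))) (proj₁ (Φ v)) (proj₂ (Φ v)))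

  f+id-injective : Injective _≡_ _≡_ (λ v → f v +ᵛ v)
  f+id-injective {u} {v} e = Φ-injective {u} {v} (skew+id-injective {Φ u} {Φ v}
    (Ψ-injective {skew+id (Φ u)} {skew+id (Φ v)} (trans (sym (f+id u)) (trans e (f+id v)))))

  f-complete : IsCompleteMapping _+ᵛ_ f
  f-complete = injective⇒bijective {f = f} f-injective , injective⇒bijective {f = λ v → f v +ᵛ v} f+id-injective

  -- On a coset the base coordinate has a constant value `y₀`, so a single fibre map acts and `g y₀`
  -- is absorbed into the translation. The linear part `φ` discards the base coordinate and ends
  -- with `B`, so it takes all its values in `W`.
  f-cosetwiseAffine : IsCosetwiseAffine W f
  f-cosetwiseAffine a = Ψ (offset A , g y₀) , ap φ , record { +-homo = ap-+ φ ; ·-homo = ap-· φ } , φ-W , on-coset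
    where
    y₀ = proj₂ (Φ a)
    A  = fibreMap y₀
    φ : Lin p (d ℕ.+ t) (d ℕ.+ t)
    φ = B ∘ˡ linear A ∘ˡ dropˡ t ∘ˡ H⁻¹
    φ-W : ∀ {w} → w ∈ W → ap φ w ∈ W
    φ-W {w} _ = comb∈W b members (ap (linear A) (proj₁ (Φ w)))
    y-const : ∀ {u} → u ∈ Coset W a → proj₂ (Φ u) ≡ y₀
    y-const {u} (w , w∈W , u≡a+w) = trans (cong (take t ∘ ap H⁻¹) u≡a+w) (trans (cong (take t) (ap-+ H⁻¹ a w))
      (trans (ap-+ (takeˡ t {d}) (ap H⁻¹ a) (ap H⁻¹ w)) (trans (cong (y₀ +ᵛ_) w-y) (𝔽ᵥ.identityʳ y₀))))
      where
      c = tabulate (proj₁ (spanning w∈W))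
      w≡Ψ : w ≡ Ψ (c , 0ᵛ)
      w≡Ψ = trans (proj₂ (spanning w∈W)) (trans (sym (comb-∑ b (proj₁ (spanning w∈W)))) (sym (Ψ-0 c)))
      w-y : proj₂ (Φ w) ≡ 0ᵛ
      w-y = cong proj₂ (trans (cong Φ w≡Ψ) (Φ-Ψ (c , 0ᵛ)))
    on-coset : ∀ {u} → u ∈ Coset W a → f u ≡ ap φ u +ᵛ Ψ (offset A , g y₀)
    on-coset {u} u∈ = trans (cong (λ y → Ψ (act (fibreMap y) (proj₁ (Φ u)) , g y)) (y-const u∈))
      (trans (cong (λ y → Ψ (act A (proj₁ (Φ u)) , y)) (sym (𝔽ᵥ.identityˡ (g y₀))))
        (trans (sym (Ψ-+ (ap (linear A) (proj₁ (Φ u))) 0ᵛ (offset A) (g y₀))) (cong (_+ᵛ Ψ (offset A , g y₀)) (Ψ-0 (ap (linear A) (proj₁ (Φ u)))))))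

  σ-injective : ∀ i → Injective _≡_ _≡_ (σ i)
  σ-injective (ℓ , i) = run-injective (factors (γ-type ℓ i)) ⟦ ℓ ⟧

  module Cycles-σ (i : I) = CyclesOfᵛ {σ = σ i} (σ-injective i)
  module Cycles-f = CyclesOfᵛ {σ = f} f-injective

  transversal-at : (ℓ : Fin (p ℕ.^ t)) → Fin (k ℓ) → List V
  transversal-at ℓ i = map (λ w → Ψ (w , rep (ℓ , i))) (Cycles-σ.representatives (ℓ , i))

  -- Every cycle of `f` meets the fibre over exactly one `rep (ℓ , i)`, and it does so in exactly
  -- one cycle of the first-return map there.
  transversal : List V
  transversal = concatTabulate λ ℓ → concatTabulate (transversal-at ℓ)

  ∈-transversal-at⁻ : ∀ {ℓ i v} → v ∈ˡ transversal-at ℓ i → ∃[ w ] v ≡ Ψ (w , rep (ℓ , i))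
  ∈-transversal-at⁻ v∈ = let w , _ , e = ∈-map⁻ _ v∈ in w , e

  across : ∀ {i j : I} → i ≢ j → ∀ {u v} → u ∈ˡ transversal-at (proj₁ i) (proj₂ i) → v ∈ˡ transversal-at (proj₁ j) (proj₂ j) → ¬ SameCycle f u v
  across {i} {j} i≢j {u} {v} u∈ v∈ s =
    let w , u≡ = ∈-transversal-at⁻ u∈ ; w′ , v≡ = ∈-transversal-at⁻ v∈ in
    i≢j (proj₁ (skew-unrelated {i} {j} {w} {w′} (SameCycle-conjugate⁻ (w , rep i) (w′ , rep j) (subst₂ (SameCycle f) u≡ v≡ s))))

  transversal-transversal : Transversal f transversal
  transversal-transversal = unrelated , covers
    where
    unrelated : AllPairs (λ u v → ¬ SameCycle f u v) transversal
    unrelated = concatTabulate-unrelated (λ ℓ → concatTabulate (transversal-at ℓ))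
      (λ ℓ → concatTabulate-unrelated (transversal-at ℓ)
        (λ i → AllPairs.map⁺ (AllPairs.map (λ {w} {w′} ¬s s → ¬s (proj₂ (skew-unrelated {ℓ , i} {ℓ , i} {w} {w′} (SameCycle-conjugate⁻ (w , rep (ℓ , i)) (w′ , rep (ℓ , i)) s))))
          (proj₁ (Cycles-σ.representatives-transversal (ℓ , i)))))
        (λ {i} {j} i≢j → across {ℓ , i} {ℓ , j} λ { refl → i≢j refl }))
      (λ {ℓ} {ℓ′} ℓ≢ℓ′ u∈ v∈ → let i , u∈′ = ∈-concatTabulate⁻ (transversal-at ℓ) u∈ ; j , v∈′ = ∈-concatTabulate⁻ (transversal-at ℓ′) v∈ in
        across {ℓ , i} {ℓ′ , j} (ℓ≢ℓ′ ∘ cong proj₁) u∈′ v∈′)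
    covers : ∀ v → ∃[ τ ] τ ∈ˡ transversal × SameCycle f τ v
    covers v =
      let (ℓ , i) , w , w∈ , same = skew-covers Cycles-σ.representatives Cycles-σ.representatives-transversal (Φ v) in
      Ψ (w , rep (ℓ , i))
      , ∈-concatTabulate⁺ (λ ℓ → concatTabulate (transversal-at ℓ)) ℓ (∈-concatTabulate⁺ (transversal-at ℓ) i (∈-map⁺ (λ w → Ψ (w , rep (ℓ , i))) w∈))
      , SameCycle-conjugate⁺ (w , rep (ℓ , i)) v same

  per-transversal-at : ∀ ℓ i → map Cycles-f.per (transversal-at ℓ i) ≡ map (⟦ ℓ ⟧ ℕ.*_) (map (Cycles-σ.per (ℓ , i)) (Cycles-σ.representatives (ℓ , i)))
  per-transversal-at ℓ i = trans (sym (List.map-∘ (Cycles-σ.representatives (ℓ , i)))) (trans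
    (List.map-cong (λ w → period-unique (Cycles-f.per-isPeriod (Ψ (w , rep (ℓ , i)))) (conjugate-period (w , rep (ℓ , i)) (⟦ ℓ ⟧ ℕ.* Cycles-σ.per (ℓ , i) w) (skew-period (ℓ , i) (Cycles-σ.per-isPeriod (ℓ , i) w))))
      (Cycles-σ.representatives (ℓ , i)))
    (List.map-∘ (Cycles-σ.representatives (ℓ , i))))

  BU-type : ∀ ℓ i → BU ⟦ ℓ ⟧ (γ ℓ i) ≈ monomial (map Cycles-f.per (transversal-at ℓ i))
  BU-type ℓ i = ≈-trans (BU-cong ⟦ ℓ ⟧ (≈-trans (type (γ-type ℓ i)) (≈-trans
      (≈-sym (CT-cong (σ-injective (ℓ , i)) (product (γ-type ℓ i)))) (Cycles-σ.cycleType-representatives (ℓ , i)))))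
    (≈-trans (BU-monomial (toℕ ℓ) (map (Cycles-σ.per (ℓ , i)) (Cycles-σ.representatives (ℓ , i))))
      (ℚ[X].reflexive (cong monomial (sym (per-transversal-at ℓ i)))))

  f-type : CT f ≈ ∏ (λ ℓ → ∏ (λ i → BU ⟦ ℓ ⟧ (γ ℓ i)))
  f-type = ≈-trans (Cycles-f.cycleType-transversal transversal transversal-transversal)
    (≈-trans (ℚ[X].reflexive (cong monomial (trans (map-concatTabulate Cycles-f.per (λ ℓ → concatTabulate (transversal-at ℓ)))
        (cong concat (List.tabulate-cong λ ℓ → map-concatTabulate Cycles-f.per (transversal-at ℓ))))))
      (≈-sym (∏-monomial (λ ℓ → concatTabulate (map Cycles-f.per ∘ transversal-at ℓ))
        λ ℓ → ∏-monomial (map Cycles-f.per ∘ transversal-at ℓ) (BU-type ℓ))))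

theorem1p3 : (p d t : ℕ) .{{_ : NonZero p}} .{{_ : NonZero d}} .{{_ : NonZero t}} →
    Prime p →
    (k : Fin (p ℕ.^ t) → ℕ) →
    (Σ[ g ∈ (𝔽[ p ]^ t → 𝔽[ p ]^ t) ]
    IsCompleteMapping _+ᵛ_ g × CT g ≈ ∏ (λ ℓ → x ⟦ ℓ ⟧ ^ k ℓ)) →
    (γ : (ℓ : Fin (p ℕ.^ t)) → Fin (k ℓ) → ℚ[x]) →
    (∀ ℓ i → γ ℓ i ∈ Γ d p ⟦ ℓ ⟧) →
    (W : Pred (𝔽[ p ]^ (d ℕ.+ t)) 0ℓ) → IsSubspace W → HasDimension W d →
    Σ[ f ∈ (𝔽[ p ]^ (d ℕ.+ t) → 𝔽[ p ]^ (d ℕ.+ t)) ]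
    IsCompleteMapping _+ᵛ_ f × IsCosetwiseAffine W f ×
    CT f ≈ ∏ (λ ℓ → ∏ (λ i → BU ⟦ ℓ ⟧ (γ ℓ i)))
theorem1p3 p d t p-prime k (g , g-complete , CT-g) γ γ∈Γ W W-subspace (b , b-basis) =
  C.f , C.f-complete , C.f-cosetwiseAffine , C.f-type
  where module C = Construction p-prime g-complete CT-g (λ ℓ i → Γ⇒isProductType p-prime (γ∈Γ ℓ i)) W-subspace b-basis
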